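{- There exists a randomized polynomial-time algorithm achieving a competitive ratio of $\frac{1}{4}$ for online Submodular Welfare in the adversarial setting with general (not necessarily monotone) non-negative submodular utilities; that is, for every instance and every adversarial arrival order of the items, the expected value $\mathbb{E}\big[\sum_{j=1}^n f_j(S_j)\big]$ of the allocation produced by the algorithm is at least $\frac14\cdot\max\big\{\sum_{j=1}^n f_j(O_j) : O_1,\dots,O_n\subseteq\mathcal N \text{ pairwise disjoint}\big\}$.
   Context: A set function $f:2^{\mathcal N}\to\mathbb R_{\ge 0}$ is submodular if $f(A\cup B)+f(A\cap B)\le f(A)+f(B)$ for all $A,B\subseteq\mathcal N$. Online Submodular Welfare: there are $n$ bidders, bidder $j$ having a non-negative submodular (not necessarily monotone) utility $f_j:2^{\mathcal N}\to\mathbb R_{\ge 0}$, and a set $\mathcal N=\{1,\dots,m\}$ of unsplittable items arriving one by one. When an item arrives, the algorithm must immediately and irrevocably assign it to one bidder or discard it; the goal is to maximize $\sum_j f_j(S_j)$, where $S_j$ is the set of items assigned to bidder $j$ (the $S_j$ are pairwise disjoint; not all items need be assigned). Utilities are accessed via value oracles, and when an item arrives the algorithm may only query sets consisting of items that have already arrived. In the adversarial setting an adversary who knows the algorithm (but not the outcomes of its random choices) fixes the arrival order. Running time counts arithmetic operations and oracle queries. -}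

module Defs where

open import Algebra.Bundles using (CommutativeRing)
open import Algebra.Structures using (IsCommutativeRing)
import Algebra.Properties.CommutativeMonoid.Sum as Sum
open import Data.Bool.Base using (if_then_else_)
open import Data.Fin.Base using (Fin; toℕ; fromℕ<)
open import Data.Fin.Permutation using (Permutation′; _⟨$⟩ʳ_)
open import Data.Fin.Subset using (Subset; inside; outside; ⊥; _∩_; _∪_; ⁅_⁆; Empty)
open import Data.Fin.Subset.Properties using (nonempty?; ∉⊥; ∩-zeroˡ)
open import Data.List.Base as List using (List; []; _∷_; _++_; map; filter; cartesianProductWith)
open import Data.List.Membership.Propositional using () renaming (_∈_ to _∈ˡ_)
open import Data.List.Membership.Propositional.Properties using (∈-map⁺; ∈-++⁺ˡ; ∈-++⁺ʳ; ∈-cartesianProductWith⁺; ∈-filter⁺)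
open import Data.List.Relation.Unary.All as All using ()
open import Data.List.Relation.Unary.All.Properties using (all-filter)
open import Data.List.Relation.Unary.Any using (here)
import Data.List.Extrema as Extrema
open import Data.Nat.Base as ℕ using (ℕ; zero; suc)
import Data.Nat.Properties as ℕ
open import Data.Product.Base using (∃-syntax; _,_)
open import Data.Vec.Base as Vec using (Vec; []; _∷_; lookup; replicate; tabulate; updateAt)
import Data.Vec.Relation.Unary.All as AllV
open import Data.Vec.Relation.Unary.AllPairs as AllPairs using (AllPairs; []; _∷_)
open import Level using (Level; _⊔_) renaming (suc to lsuc)
open import Relation.Binary.Bundles using (TotalOrder)
open import Relation.Binary.Core using (Rel)
open import Relation.Binary.PropositionalEquality using (refl; subst)
open import Relation.Binary.Structures using (IsDecTotalOrder)
open import Relation.Nullary using (¬_; yes; no; does; ¬?)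
open import Relation.Unary using (Decidable)

-- Linearly ordered fields, standing in for ℝ (which classically is one of
-- them).  As usual for a total inverse, 0# ⁻¹ is 0#.
record OrderedField (c ℓ₁ ℓ₂ : Level) : Set (lsuc (c ⊔ ℓ₁ ⊔ ℓ₂)) where
  infix  8 _⁻¹
  infix  8 -_
  infixl 7 _*_
  infixl 6 _+_ _-_
  infix  4 _≈_ _≤_
  field
    Carrier           : Set c
    _≈_               : Rel Carrier ℓ₁
    _≤_               : Rel Carrier ℓ₂
    _+_ _*_           : Carrier → Carrier → Carrier
    -_ _⁻¹            : Carrier → Carrier
    0# 1#             : Carrier
    isCommutativeRing : IsCommutativeRing _≈_ _+_ _*_ -_ 0# 1#
    isDecTotalOrder   : IsDecTotalOrder _≈_ _≤_
    1≉0               : ¬ (1# ≈ 0#)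
    ⁻¹-cong           : ∀ {x y} → x ≈ y → x ⁻¹ ≈ y ⁻¹
    ⁻¹-inverseʳ       : ∀ {x} → ¬ (x ≈ 0#) → x * x ⁻¹ ≈ 1#
    0⁻¹≈0             : 0# ⁻¹ ≈ 0#
    +-monoʳ-≤         : ∀ z {x y} → x ≤ y → z + x ≤ z + y
    *-nonNegative     : ∀ {x y} → 0# ≤ x → 0# ≤ y → 0# ≤ x * y

  open IsDecTotalOrder isDecTotalOrder public using (_≤?_; isTotalOrder)

  commutativeRing : CommutativeRing c ℓ₁
  commutativeRing = record { isCommutativeRing = isCommutativeRing }

  open CommutativeRing commutativeRing public using (+-commutativeMonoid)

  totalOrder : TotalOrder c ℓ₁ ℓ₂
  totalOrder = record { isTotalOrder = isTotalOrder }

  _-_ : Carrier → Carrier → Carrier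
  x - y = x + (- y)

  ½ ¼ : Carrier
  ½ = (1# + 1#) ⁻¹
  ¼ = (1# + 1# + 1# + 1#) ⁻¹

------------------------------------------------------------------------
-- Allocations

-- Component j is the set of items given to bidder j.
Allocation : ℕ → ℕ → Set
Allocation n m = Vec (Subset m) n

PairwiseDisjoint : ∀ {n m} → Allocation n m → Set
PairwiseDisjoint = AllPairs (λ A B → Empty (A ∩ B))

pairwiseDisjoint? : ∀ {n m} → Decidable (PairwiseDisjoint {n} {m})
pairwiseDisjoint? = AllPairs.allPairs? (λ A B → ¬? (nonempty? (A ∩ B)))

nothing-allocated : ∀ {n m} → Allocation n m
nothing-allocated = replicate _ ⊥

subsets : ∀ m → List (Subset m)
subsets zero    = [] ∷ []
subsets (suc m) = map (outside ∷_) (subsets m) ++ map (inside ∷_) (subsets m)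

families : ∀ n m → List (Allocation n m)
families zero    m = [] ∷ []
families (suc n) m = cartesianProductWith _∷_ (subsets m) (families n m)

feasible : ∀ n m → List (Allocation n m)
feasible n m = filter pairwiseDisjoint? (families n m)

∈-subsets : ∀ {m} (A : Subset m) → A ∈ˡ subsets m
∈-subsets []            = here refl
∈-subsets (outside ∷ A) = ∈-++⁺ˡ (∈-map⁺ _ (∈-subsets A))
∈-subsets (inside  ∷ A) = ∈-++⁺ʳ _ (∈-map⁺ _ (∈-subsets A))

∈-families : ∀ {n m} (O : Allocation n m) → O ∈ˡ families n m
∈-families []      = here refl
∈-families (A ∷ O) = ∈-cartesianProductWith⁺ _∷_ (∈-subsets A) (∈-families O)

nothing-disjoint : ∀ n {m} → PairwiseDisjoint (nothing-allocated {n} {m})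
nothing-disjoint zero        = []
nothing-disjoint (suc n) {m} = apart n ∷ nothing-disjoint n
  where
  apart : ∀ k → AllV.All (λ B → Empty (⊥ ∩ B)) (replicate k (⊥ {m}))
  apart zero    = AllV.[]
  apart (suc k) = (λ (x , x∈) → ∉⊥ (subst (Vec._[ x ]= inside) (∩-zeroˡ ⊥) x∈)) AllV.∷ apart k

------------------------------------------------------------------------
-- Randomized computations

-- Binary trees of fair coin flips, with one tick per unit of time.
data Comp {a} (A : Set a) : Set a where
  return : A → Comp A
  tick   : Comp A → Comp A
  flip   : Comp A → Comp A → Comp A

module _ {a b} {A : Set a} {B : Set b} where

  infixl 1 _>>=_

  _>>=_ : Comp A → (A → Comp B) → Comp B
  return x >>= k = k x
  tick p   >>= k = tick (p >>= k)
  flip p q >>= k = flip (p >>= k) (q >>= k)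

module _ {a} {A : Set a} where

  iterate : ℕ → (A → Comp A) → A → Comp A
  iterate zero    body s = return s
  iterate (suc k) body s = tick (body s) >>= iterate k body

  -- Running time under the worst outcome of the coins.
  time : Comp A → ℕ
  time (return _) = 0
  time (tick p)   = suc (time p)
  time (flip p q) = time p ℕ.⊔ time q

------------------------------------------------------------------------
-- Programs

data Arith : Set where
  add sub mul div : Arith

-- A random access machine with two kinds of data: natural numbers (for
-- indices) and elements of the ordered field.  For each kind there are
-- registers, named by constants of the program, and a memory whose cells are
-- addressed by a pair (row, column) of index registers.  Indices have
-- addition and truncated subtraction only, so that charging one time unit per
-- operation is realistic.
--
-- Naming: x y z are index registers, a b c are field registers.
data Program : Set where
  skip      : Program
  _⨾_       : Program → Program → Program
  setᵢ      : (x k : ℕ) → Program                -- x := the constant k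
  addᵢ subᵢ : (x y z : ℕ) → Program              -- x := y + z, x := y ∸ z
  loadᵢ     : (x y z : ℕ) → Program              -- x := memory[y][z]
  storeᵢ    : (y z x : ℕ) → Program              -- memory[y][z] := x
  if_≤ᵢ_then_else_ : (x y : ℕ) → Program → Program → Program
  set0 set1 : (a : ℕ) → Program
  arith     : Arith → (a b c : ℕ) → Program      -- a := b ⋆ c
  loadₖ     : (a y z : ℕ) → Program              -- a := memory[y][z]
  storeₖ    : (y z a : ℕ) → Program              -- memory[y][z] := a
  if_≤ₖ_then_else_ : (a b : ℕ) → Program → Program → Program
  query     : (a x y : ℕ) → Program              -- a := f_x ({ i ∣ memory[y][i] ≠ 0 })
  coin      : (x : ℕ) → Program                  -- x := a uniformly random bit
  loop      : (x : ℕ) → Program → Program        -- run the body x times (x read once, on entry)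

infixr 5 _⨾_

_[_↦_] : ∀ {a} {A : Set a} → (ℕ → A) → ℕ → A → (ℕ → A)
(g [ x ↦ v ]) y = if does (y ℕ.≟ x) then v else g y

-- The program is run once per arriving item.  All of its data persists
-- between arrivals.
Algorithm : Set
Algorithm = Program

-- The interface between an algorithm and its environment: initially
-- bidders-reg holds the number n of bidders (the number of items is not
-- revealed); on each arrival item-reg receives the name of the arriving item;
-- afterwards output-reg is read, where 0 means that the item is discarded,
-- suc j that it is assigned to bidder j < n (other values discard it, too).
bidders-reg item-reg output-reg : ℕ
bidders-reg = 0
item-reg    = 1
output-reg  = 2

module OnlineWelfare {c ℓ₁ ℓ₂} (K : OrderedField c ℓ₁ ℓ₂) where

  open OrderedField K
  open Sum +-commutativeMonoid using (sum)
  open Extrema totalOrder using (argmax; argmax-all; f[xs]≤f[argmax])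

  𝔼 : ∀ {a} {A : Set a} → Comp A → (A → Carrier) → Carrier
  𝔼 (return x) v = v x
  𝔼 (tick p)   v = 𝔼 p v
  𝔼 (flip p q) v = ½ * (𝔼 p v + 𝔼 q v)

  NonNegative Submodular : ∀ {m} → (Subset m → Carrier) → Set ℓ₂
  NonNegative f = ∀ A → 0# ≤ f A
  Submodular  f = ∀ A B → f (A ∪ B) + f (A ∩ B) ≤ f A + f B

  record Instance (n m : ℕ) : Set (c ⊔ ℓ₂) where
    field
      utility     : Fin n → Subset m → Carrier
      nonNegative : ∀ j → NonNegative (utility j)
      submodular  : ∀ j → Submodular (utility j)

  open Instance public

  welfare : ∀ {n m} → Instance n m → Allocation n m → Carrier
  welfare I S = sum (λ j → utility I j (lookup S j))

  optimal-allocation : ∀ {n m} → Instance n m → Allocation n m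
  optimal-allocation I = argmax (welfare I) nothing-allocated (feasible _ _)

  optimum : ∀ {n m} → Instance n m → Carrier
  optimum I = welfare I (optimal-allocation I)

  optimal-disjoint : ∀ {n m} (I : Instance n m) → PairwiseDisjoint (optimal-allocation I)
  optimal-disjoint {n} {m} I = argmax-all (welfare I) (nothing-disjoint n)
    (all-filter pairwiseDisjoint? (families n m))

  optimal-maximum : ∀ {n m} (I : Instance n m) (O : Allocation n m) →
                    PairwiseDisjoint O → welfare I O ≤ optimum I
  optimal-maximum {n} {m} I O disj = All.lookup (f[xs]≤f[argmax] nothing-allocated (feasible n m))
    (∈-filter⁺ pairwiseDisjoint? (∈-families O) disj)

  record State : Set c where
    constructor state
    field
      regᵢ : ℕ → ℕ
      memᵢ : ℕ → ℕ → ℕ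
      regₖ : ℕ → Carrier
      memₖ : ℕ → ℕ → Carrier

  open State public

  set-regᵢ : ℕ → ℕ → State → State
  set-regᵢ x v σ = record σ { regᵢ = regᵢ σ [ x ↦ v ] }

  set-regₖ : ℕ → Carrier → State → State
  set-regₖ a v σ = record σ { regₖ = regₖ σ [ a ↦ v ] }

  ⟦_⟧ : Arith → Carrier → Carrier → Carrier
  ⟦ add ⟧ u v = u + v
  ⟦ sub ⟧ u v = u - v
  ⟦ mul ⟧ u v = u * v
  ⟦ div ⟧ u v = u * v ⁻¹

  -- A value oracle takes the number of a bidder and the indicator function
  -- of a set of items (nonzero means membership).
  Oracle : Set c
  Oracle = ℕ → (ℕ → ℕ) → Carrier

  exec : Oracle → Program → State → Comp State
  exec f skip             σ = return σ
  exec f (P ⨾ Q)          σ = exec f P σ >>= exec f Q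
  exec f (setᵢ x k)       σ = tick (return (set-regᵢ x k σ))
  exec f (addᵢ x y z)     σ = tick (return (set-regᵢ x (regᵢ σ y ℕ.+ regᵢ σ z) σ))
  exec f (subᵢ x y z)     σ = tick (return (set-regᵢ x (regᵢ σ y ℕ.∸ regᵢ σ z) σ))
  exec f (loadᵢ x y z)    σ = tick (return (set-regᵢ x (memᵢ σ (regᵢ σ y) (regᵢ σ z)) σ))
  exec f (storeᵢ y z x)   σ = tick (return record σ
    { memᵢ = memᵢ σ [ regᵢ σ y ↦ memᵢ σ (regᵢ σ y) [ regᵢ σ z ↦ regᵢ σ x ] ] })
  exec f (if x ≤ᵢ y then P else Q) σ =
    tick (if does (regᵢ σ x ℕ.≤? regᵢ σ y) then exec f P σ else exec f Q σ)
  exec f (set0 a)         σ = tick (return (set-regₖ a 0# σ))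
  exec f (set1 a)         σ = tick (return (set-regₖ a 1# σ))
  exec f (arith op a b c) σ = tick (return (set-regₖ a (⟦ op ⟧ (regₖ σ b) (regₖ σ c)) σ))
  exec f (loadₖ a y z)    σ = tick (return (set-regₖ a (memₖ σ (regᵢ σ y) (regᵢ σ z)) σ))
  exec f (storeₖ y z a)   σ = tick (return record σ
    { memₖ = memₖ σ [ regᵢ σ y ↦ memₖ σ (regᵢ σ y) [ regᵢ σ z ↦ regₖ σ a ] ] })
  exec f (if a ≤ₖ b then P else Q) σ =
    tick (if does (regₖ σ a ≤? regₖ σ b) then exec f P σ else exec f Q σ)
  exec f (query a x y)    σ = tick (return (set-regₖ a (f (regᵢ σ x) (memᵢ σ (regᵢ σ y))) σ))
  exec f (coin x)         σ = tick (flip (return (set-regᵢ x 0 σ)) (return (set-regᵢ x 1 σ)))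
  exec f (loop x P)       σ = tick (iterate (regᵢ σ x) (exec f P) σ)

  module _ {n m : ℕ} (A : Algorithm) (I : Instance n m) where

    -- Items that have not arrived yet are dropped from every queried set.
    oracle : (arrived : Subset m) → Oracle
    oracle arrived j χ with j ℕ.<? n
    ... | yes j<n = utility I (fromℕ< j<n) (tabulate (λ i → does (1 ℕ.≤? χ (toℕ i))) ∩ arrived)
    ... | no  _   = 0#

    assign : (output : ℕ) → Fin m → Allocation n m → Allocation n m
    assign zero    u S = S
    assign (suc j) u S with j ℕ.<? n
    ... | yes j<n = updateAt S (fromℕ< j<n) (_∪ ⁅ u ⁆)
    ... | no  _   = S

    serve : (arrivals : List (Fin m)) (arrived : Subset m) → State → Allocation n m →
            Comp (Allocation n m)
    serve []       arrived σ S = return S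
    serve (u ∷ us) arrived σ S =
      exec (oracle (arrived ∪ ⁅ u ⁆)) A (set-regᵢ item-reg (toℕ u) σ) >>= λ σ′ →
      serve us (arrived ∪ ⁅ u ⁆) σ′ (assign (regᵢ σ′ output-reg) u S)

    initial : State
    initial = set-regᵢ bidders-reg n (state (λ _ → 0) (λ _ _ → 0) (λ _ → 0#) (λ _ _ → 0#))

    -- The item arriving at time t is π ⟨$⟩ʳ t.
    run : (π : Permutation′ m) → Comp (Allocation n m)
    run π = serve (List.tabulate (π ⟨$⟩ʳ_)) ⊥ initial nothing-allocated

  PolynomialTime : Algorithm → Set (c ⊔ ℓ₂)
  PolynomialTime A = ∃[ C ] ∃[ d ] (∀ {n m} (I : Instance n m) (π : Permutation′ m) →
    time (run A I π) ℕ.≤ C ℕ.* suc (n ℕ.+ m) ℕ.^ d)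

{-# OPTIONS --safe #-}

-- When item u arrives, every bidder flips a fair coin, and u goes to the bidder
-- of largest marginal gain among those who flipped heads (to nobody if all these
-- gains are negative).  Let O be an allocation and S the (random) outcome, and
-- write f for total welfare; unions and intersections are taken bidder by bidder.
--
-- (1) E f(S ∪ O) ≤ 2 E f(S).  When u arrives, 2 f(S) − f(S ∪ (O ∩ arrived))
-- increases by at least the gain of the bidder selected, minus the gain g ≥ 0 of the
-- bidder o owning u in O unless o is selected itself.  Pair the outcomes of the
-- coins that differ in the coin of o only: if the best other bidder gains at
-- least g, it pays for the loss in both outcomes; otherwise o is selected in one
-- of them, and its gain g there pays for the loss in the other one.
--
-- (2) E f_j(S_j ∪ O_j) ≥ ½ f_j(O_j).  Two runs with opposite coins for bidder j
-- give j disjoint sets A and B, and submodularity and non-negativity yield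
-- f_j(A ∪ O_j) + f_j(B ∪ O_j) ≥ f_j(O_j).
module Submission where

open import Defs
open import Algebra.Bundles using (CommutativeRing)
import Algebra.Properties.CommutativeMonoid.Sum as Sum
import Algebra.Properties.Ring as RingProperties
import Algebra.Solver.Ring.NaturalCoefficients.Default as Solver
open import Data.Bool.Base using (if_then_else_; _∨_)
open import Data.Bool.Properties using (∨-identityʳ; ¬-not)
open import Data.Fin.Base using (Fin; zero; suc; toℕ; fromℕ<)
open import Data.Fin.Permutation using (Permutation′; _⟨$⟩ʳ_; _⟨$⟩ˡ_; inverseʳ; inverseˡ)
open import Data.Fin.Properties using (_≟_; toℕ-fromℕ<; toℕ-injective; any?; toℕ<n; fromℕ<-toℕ)
open import Data.Fin.Subset using (Subset; ⊥; ⊤; _∩_; _∪_; ⁅_⁆; _∈_; _∉_; _⊆_; inside; outside)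
open import Data.Fin.Subset.Properties
  using ( _∈?_; ∉⊥; ⊆-antisym; ⊆-refl; ⊆-trans; x∈p∪q⁻; x∈p∩q⁺; x∈p∩q⁻; x∈⁅x⁆; x∈⁅y⁆⇒x≡y; p⊆p∪q; q⊆p∪q
        ; ∪-assoc; ∪-comm; ∪-idem; ∪-identityˡ; ∩-idem; ∩-comm; ∩-zeroʳ; ∩-identityʳ; ∪-distribʳ-∩; ∩-distribˡ-∪
        ; ⊆⊤; ⊆-reflexive; x≢y⇒x∉⁅y⁆)
open import Data.List.Base as List using (List; []; _∷_)
open import Data.List.Membership.Propositional using () renaming (_∈_ to _∈ˡ_)
open import Data.List.Membership.Propositional.Properties using (∈-tabulate⁺)
open import Data.List.Properties using (length-tabulate)
open import Data.List.Relation.Unary.All as All using (All; []; _∷_)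
open import Data.List.Relation.Unary.AllPairs using ([]; _∷_)
open import Data.List.Relation.Unary.Any using (here; there)
open import Data.List.Relation.Unary.Unique.Propositional using (Unique)
open import Data.List.Relation.Unary.Unique.Propositional.Properties using (tabulate⁺)
open import Data.Maybe.Base using (Maybe; just; nothing)
open import Data.Maybe.Properties using (just-injective; ≡-dec)
open import Data.Nat.Base as ℕ using (ℕ; zero; suc)
import Data.Nat.Properties as ℕ
open import Data.Product.Base using (_×_; _,_; proj₁; proj₂; Σ-syntax)
open import Data.Sum.Base using (_⊎_; inj₁; inj₂; [_,_]′)
import Data.Unit.Base as Unit
open import Data.Vec.Base using ([]; _∷_; lookup; updateAt)
open import Data.Vec.Properties
  using ( lookup∘updateAt; lookup∘updateAt′; lookup-replicate; tabulate-cong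
        ; tabulate∘lookup; []=⇒lookup; lookup⇒[]=; lookup-zipWith)
import Data.Vec.Relation.Unary.All.Properties as AllV
open import Data.Vec.Relation.Unary.AllPairs using ([]; _∷_)
open import Function.Base using (_∘_; id)
open import Level using (_⊔_)
open import Relation.Binary.Bundles using (TotalOrder)
open import Relation.Binary.PropositionalEquality as ≡ using (_≡_; _≢_)
import Relation.Binary.Reasoning.PartialOrder as PartialOrderReasoning
open import Relation.Nullary using (¬_; Dec; yes; no; does; contradiction)
open import Relation.Nullary.Decidable using (dec-true; dec-false)

-- Bidders in descending order

below : ∀ {n} k → .(k ℕ.≤ n) → List (Fin n)
below zero    _ = []
-- The largest index comes first because the row register of the program counts down from `n`. The
-- bound is irrelevant, so different proofs of it give the same list.
below (suc k) p = fromℕ< p ∷ below k (ℕ.<⇒≤ p)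

below-< : ∀ {n} k .(p : k ℕ.≤ n) → All (λ j → toℕ j ℕ.< k) (below k p)
below-< zero    _ = []
below-< (suc k) p = ℕ.s≤s (ℕ.≤-reflexive (toℕ-fromℕ< p)) ∷ All.map ℕ.m<n⇒m<1+n (below-< k (ℕ.<⇒≤ p))

below-unique : ∀ {n} k .(p : k ℕ.≤ n) → Unique (below k p)
below-unique zero    _ = []
below-unique (suc k) p =
  All.map (λ { j<k ≡.refl → ℕ.<-irrefl (toℕ-fromℕ< p) j<k }) (below-< k (ℕ.<⇒≤ p)) ∷
  below-unique k (ℕ.<⇒≤ p)

∈-below : ∀ {n} k .(p : k ℕ.≤ n) {j : Fin n} → toℕ j ℕ.< k → j ∈ˡ below k p
∈-below (suc k) p {j} j<1+k with toℕ j ℕ.≟ k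
... | yes j≡k = here (toℕ-injective (≡.trans j≡k (≡.sym (toℕ-fromℕ< p))))
... | no  j≢k = there (∈-below k (ℕ.<⇒≤ p) (ℕ.≤∧≢⇒< (ℕ.s≤s⁻¹ j<1+k) j≢k))

-- Arithmetic of ordered fields

module OrderedFieldProperties {c ℓ₁ ℓ₂} (K : OrderedField c ℓ₁ ℓ₂) where

  open OrderedField K
  open CommutativeRing commutativeRing public
    using ( +-cong; +-congˡ; +-congʳ; *-congˡ; *-congʳ; +-identityˡ; +-identityʳ; -‿inverseʳ; +-assoc; +-comm
          ; *-assoc; *-identityˡ; *-identityʳ; zeroʳ; distribˡ; commutativeSemiring; ring)
  open RingProperties ring using (-‿distribˡ-*; -‿distribʳ-*; -‿involutive)
  open TotalOrder totalOrder public
    using (module Eq; poset; total; antisym; ≤-respˡ-≈; ≤-respʳ-≈)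
    renaming (refl to ≤-refl; trans to ≤-trans; reflexive to ≤-reflexive)
  open Solver commutativeSemiring public using (solve; _:+_; _:*_; _:=_; con)
  open PartialOrderReasoning poset public
  open Sum +-commutativeMonoid public using (sum; sum-cong-≋; ∑-distrib-+; sum-replicate-zero)

  +-mono-≤ : ∀ {w x y z} → w ≤ x → y ≤ z → w + y ≤ x + z
  +-mono-≤ {w} {x} {y} {z} w≤x y≤z = begin
    w + y ≤⟨ +-monoʳ-≤ w y≤z ⟩
    w + z ≈⟨ +-comm w z ⟩
    z + w ≤⟨ +-monoʳ-≤ z w≤x ⟩
    z + x ≈⟨ +-comm z x ⟩
    x + z ∎

  x+y-y≈x : ∀ x y → x + y + (- y) ≈ x
  x+y-y≈x x y = Eq.trans (+-assoc x y (- y)) (Eq.trans (+-congˡ (-‿inverseʳ y)) (+-identityʳ x))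

  x-y+y≈x : ∀ x y → x - y + y ≈ x
  x-y+y≈x x y = Eq.trans (+-assoc x (- y) y)
    (Eq.trans (+-congˡ (Eq.trans (+-comm (- y) y) (-‿inverseʳ y))) (+-identityʳ x))

  +-cancelʳ-≤ : ∀ z {x y} → x + z ≤ y + z → x ≤ y
  +-cancelʳ-≤ z {x} {y} x+z≤y+z = begin
    x             ≈⟨ x+y-y≈x x z ⟨
    x + z + (- z) ≤⟨ +-mono-≤ x+z≤y+z ≤-refl ⟩
    y + z + (- z) ≈⟨ x+y-y≈x y z ⟩
    y             ∎

  -- The certificate is an equation without subtraction, so that the semiring
  -- solver proves it.
  ≤-from : ∀ {l r x y} → l ≤ r → x + r ≈ y + l → x ≤ y
  ≤-from {l} {r} {x} {y} l≤r x+r≈y+l = +-cancelʳ-≤ r (begin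
    x + r ≈⟨ x+r≈y+l ⟩
    y + l ≤⟨ +-monoʳ-≤ y l≤r ⟩
    y + r ∎)

  ≰⇒≥ : ∀ {x y} → ¬ (x ≤ y) → y ≤ x
  ≰⇒≥ {x} {y} x≰y with total x y
  ... | inj₁ x≤y = contradiction x≤y x≰y
  ... | inj₂ y≤x = y≤x

  _⁺ : Carrier → Carrier
  x ⁺ = if does (0# ≤? x) then x else 0#

  0≤x⁺ : ∀ x → 0# ≤ x ⁺
  0≤x⁺ x with 0# ≤? x
  ... | yes 0≤x = 0≤x
  ... | no  _   = ≤-refl

  x≤x⁺ : ∀ x → x ≤ x ⁺
  x≤x⁺ x with 0# ≤? x
  ... | yes _   = ≤-refl
  ... | no  0≰x = [ (λ 0≤x → contradiction 0≤x 0≰x) , id ]′ (total 0# x)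

  ⁺-least : ∀ x {y} → 0# ≤ y → x ≤ y → x ⁺ ≤ y
  ⁺-least x 0≤y x≤y with 0# ≤? x
  ... | yes _ = x≤y
  ... | no  _ = 0≤y

  x*x≥0 : ∀ x → 0# ≤ x * x
  x*x≥0 x with total 0# x
  ... | inj₁ 0≤x = *-nonNegative 0≤x 0≤x
  ... | inj₂ x≤0 = ≤-respʳ-≈ -x*-x≈x*x (*-nonNegative 0≤-x 0≤-x)
    where
    0≤-x : 0# ≤ - x
    0≤-x = ≤-from x≤0 (Eq.trans (+-identityʳ 0#) (Eq.trans (Eq.sym (-‿inverseʳ x)) (+-comm x (- x))))
    -x*-x≈x*x : (- x) * (- x) ≈ x * x
    -x*-x≈x*x = Eq.trans (Eq.sym (-‿distribˡ-* x (- x)))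
      (Eq.trans (CommutativeRing.-‿cong commutativeRing (Eq.sym (-‿distribʳ-* x x))) (-‿involutive (x * x)))

  0≤1 : 0# ≤ 1#
  0≤1 = ≤-respʳ-≈ (*-identityˡ 1#) (x*x≥0 1#)

  2≉0 : ¬ (1# + 1# ≈ 0#)
  2≉0 2≈0 = 1≉0 (antisym (≤-from 0≤1 (Eq.trans 2≈0 (Eq.sym (+-identityˡ 0#)))) 0≤1)

  2*½≈1 : (1# + 1#) * ½ ≈ 1#
  2*½≈1 = ⁻¹-inverseʳ 2≉0

  ½+½≈1 : ½ + ½ ≈ 1#
  ½+½≈1 = Eq.trans (solve 1 (λ h → h :+ h := (con 1 :+ con 1) :* h) Eq.refl ½) 2*½≈1

  -- The axioms do not give the sign of an inverse directly, but `½` is a sum of two squares,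
  -- `½ * ½ + ½ * ½`.
  0≤½ : 0# ≤ ½
  0≤½ = ≤-respʳ-≈ 2½½≈½ (≤-trans (≤-reflexive (Eq.sym (+-identityˡ 0#))) (+-mono-≤ (x*x≥0 ½) (x*x≥0 ½)))
    where
    2½½≈½ : ½ * ½ + ½ * ½ ≈ ½
    2½½≈½ = Eq.trans (Eq.sym (distribˡ ½ ½ ½)) (Eq.trans (*-congˡ ½+½≈1) (*-identityʳ ½))

  ½½≈¼ : ½ * ½ ≈ ¼
  ½½≈¼ = begin-equality
    ½ * ½                                 ≈⟨ *-identityʳ _ ⟨
    ½ * ½ * 1#                            ≈⟨ *-congˡ (⁻¹-inverseʳ 4≉0) ⟨
    ½ * ½ * (4# * ¼)                      ≈⟨ solve 2 (λ h q → h :* h :* ((con 1 :+ con 1 :+ con 1 :+ con 1) :* q)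
                                               := ((con 1 :+ con 1) :* h) :* ((con 1 :+ con 1) :* h) :* q) Eq.refl ½ ¼ ⟩
    (1# + 1#) * ½ * ((1# + 1#) * ½) * ¼   ≈⟨ *-congʳ (Eq.trans (*-congʳ 2*½≈1) (Eq.trans (*-identityˡ _) 2*½≈1)) ⟩
    1# * ¼                                ≈⟨ *-identityˡ ¼ ⟩
    ¼                                     ∎
    where
    4# = 1# + 1# + 1# + 1#
    4≉0 : ¬ (4# ≈ 0#)
    -- Halving `4# ≈ 0#` gives `1# + 1# ≈ 0#`.
    4≉0 4≈0 = 2≉0 (begin-equality
      1# + 1#               ≈⟨ *-identityʳ _ ⟨
      (1# + 1#) * 1#        ≈⟨ *-congˡ 2*½≈1 ⟨
      (1# + 1#) * ((1# + 1#) * ½) ≈⟨ solve 1 (λ h → (con 1 :+ con 1) :* ((con 1 :+ con 1) :* h)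
                                  := h :* (con 1 :+ con 1 :+ con 1 :+ con 1)) Eq.refl ½ ⟩
      ½ * 4#                ≈⟨ *-congˡ 4≈0 ⟩
      ½ * 0#                ≈⟨ zeroʳ ½ ⟩
      0#                    ∎)

  ½*-mono-≤ : ∀ {x y} → x ≤ y → ½ * x ≤ ½ * y
  ½*-mono-≤ {x} {y} x≤y = begin
    ½ * x                 ≈⟨ +-identityˡ _ ⟨
    0# + ½ * x            ≤⟨ +-mono-≤ (*-nonNegative 0≤½ 0≤y-x) ≤-refl ⟩
    ½ * (y - x) + ½ * x   ≈⟨ distribˡ ½ (y - x) x ⟨
    ½ * (y - x + x)       ≈⟨ *-congˡ (x-y+y≈x y x) ⟩
    ½ * y                 ∎
    where
    0≤y-x : 0# ≤ y - x
    0≤y-x = ≤-respˡ-≈ (-‿inverseʳ x) (+-mono-≤ x≤y ≤-refl)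

  average-self : ∀ x → ½ * (x + x) ≈ x
  average-self x = Eq.trans (solve 2 (λ h x → h :* (x :+ x) := (h :+ h) :* x) Eq.refl ½ x)
    (Eq.trans (*-congʳ ½+½≈1) (*-identityˡ x))

  average-exchange : ∀ a b c d → ½ * (a + b) + ½ * (c + d) ≈ ½ * ((a + c) + (b + d))
  average-exchange = solve 5 (λ h a b c d → h :* (a :+ b) :+ h :* (c :+ d) := h :* ((a :+ c) :+ (b :+ d))) Eq.refl ½

  sum-mono-≤ : ∀ {n} {s t : Fin n → Carrier} → (∀ i → s i ≤ t i) → sum s ≤ sum t
  sum-mono-≤ {zero}  s≤t = ≤-refl
  sum-mono-≤ {suc n} s≤t = +-mono-≤ (s≤t zero) (sum-mono-≤ (s≤t ∘ suc))

  sum-zero : ∀ {n} {t : Fin n → Carrier} → (∀ i → t i ≈ 0#) → sum t ≈ 0#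
  sum-zero {n} t≈0 = Eq.trans (sum-cong-≋ t≈0) (sum-replicate-zero n)

  sum-single : ∀ {n} (t : Fin n → Carrier) i → (∀ j → j ≢ i → t j ≈ 0#) → sum t ≈ t i
  sum-single t zero    others = Eq.trans (+-congˡ (sum-zero (λ j → others (suc j) λ ()))) (+-identityʳ _)
  sum-single t (suc i) others =
    Eq.trans (+-cong (others zero λ ()) (sum-single (t ∘ suc) i (λ j j≢i → others (suc j) λ { ≡.refl → j≢i ≡.refl })))
      (+-identityˡ _)

-- Expectation over trees of coin flips

module Expectation {c ℓ₁ ℓ₂} (K : OrderedField c ℓ₁ ℓ₂) where

  open OrderedField K
  open OrderedFieldProperties K
  open OnlineWelfare K using (𝔼)

  module _ {a} {A : Set a} where

    𝔼-mono : ∀ (p : Comp A) {v w} → (∀ x → v x ≤ w x) → 𝔼 p v ≤ 𝔼 p w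
    𝔼-mono (return x) v≤w = v≤w x
    𝔼-mono (tick p)   v≤w = 𝔼-mono p v≤w
    𝔼-mono (flip p q) v≤w = ½*-mono-≤ (+-mono-≤ (𝔼-mono p v≤w) (𝔼-mono q v≤w))

    𝔼-cong : ∀ (p : Comp A) {v w} → (∀ x → v x ≈ w x) → 𝔼 p v ≈ 𝔼 p w
    𝔼-cong p v≈w = antisym (𝔼-mono p (≤-reflexive ∘ v≈w)) (𝔼-mono p (≤-reflexive ∘ Eq.sym ∘ v≈w))

    𝔼-const : ∀ (p : Comp A) x → 𝔼 p (λ _ → x) ≈ x
    𝔼-const (return _) x = Eq.refl
    𝔼-const (tick p)   x = 𝔼-const p x
    𝔼-const (flip p q) x = Eq.trans (*-congˡ (+-cong (𝔼-const p x) (𝔼-const q x))) (average-self x)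

    𝔼-+ : ∀ (p : Comp A) v w → 𝔼 p (λ x → v x + w x) ≈ 𝔼 p v + 𝔼 p w
    𝔼-+ (return x) v w = Eq.refl
    𝔼-+ (tick p)   v w = 𝔼-+ p v w
    𝔼-+ (flip p q) v w = Eq.trans (*-congˡ (+-cong (𝔼-+ p v w) (𝔼-+ q v w)))
      (solve 5 (λ h a b c d → h :* ((a :+ b) :+ (c :+ d)) := h :* (a :+ c) :+ h :* (b :+ d)) Eq.refl
         ½ (𝔼 p v) (𝔼 p w) (𝔼 q v) (𝔼 q w))

    𝔼-sum : ∀ {n} (p : Comp A) (v : Fin n → A → Carrier) →
            𝔼 p (λ x → sum (λ j → v j x)) ≈ sum (λ j → 𝔼 p (v j))
    𝔼-sum {zero}  p v = 𝔼-const p 0#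
    𝔼-sum {suc n} p v = Eq.trans (𝔼-+ p (v zero) _) (+-congˡ (𝔼-sum p (v ∘ suc)))

    𝔼->>= : ∀ {b} {B : Set b} (p : Comp A) (k : A → Comp B) v →
            𝔼 (p >>= k) v ≈ 𝔼 p (λ x → 𝔼 (k x) v)
    𝔼->>= (return x) k v = Eq.refl
    𝔼->>= (tick p)   k v = 𝔼->>= p k v
    𝔼->>= (flip p q) k v = *-congˡ (+-cong (𝔼->>= p k v) (𝔼->>= q k v))

-- The randomized auction for a single item

module Auction {c ℓ₁ ℓ₂} (K : OrderedField c ℓ₁ ℓ₂) {n : ℕ} where

  open OrderedField K
  open OrderedFieldProperties K
  open Expectation K
  open OnlineWelfare K using (𝔼)

  module _ (w : Maybe (Fin n) → Carrier) where

    -- Ties go to the newcomer, in agreement with the test `best-reg ≤ₖ gain-reg` of the program.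
    better : Maybe (Fin n) → Fin n → Maybe (Fin n)
    better b j = if does (w b ≤? w (just j)) then just j else b

    -- Each coin is flipped only when its bidder is reached, so the running best is the whole state.
    -- The first branch is tails, as for `coin`.
    scan : List (Fin n) → Maybe (Fin n) → Comp (Maybe (Fin n))
    scan []       b = return b
    scan (j ∷ js) b = flip (scan js b) (scan js (better b j))

    -- A view of `better`: one case split yields both the winner and the comparison that decided it.
    data Better b j : Maybe (Fin n) → Set ℓ₂ where
      replaced : w b ≤ w (just j) → Better b j (just j)
      kept     : ¬ (w b ≤ w (just j)) → Better b j b

    better-view : ∀ b j → Better b j (better b j)
    better-view b j with w b ≤? w (just j)
    ... | yes b≤j = replaced b≤j
    ... | no  b≰j = kept b≰j

    better-≥ : ∀ b j → w b ≤ w (better b j)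
    better-≥ b j with better b j | better-view b j
    ... | _ | replaced b≤j = b≤j
    ... | _ | kept _       = ≤-refl

    -- No step of the scan lowers the worth of the running best, whatever the coins.
    scan-≥ : ∀ js b → w b ≤ 𝔼 (scan js b) w
    scan-≥ []       b = ≤-refl
    scan-≥ (j ∷ js) b = begin
      w b             ≈⟨ average-self (w b) ⟨
      ½ * (w b + w b) ≤⟨ ½*-mono-≤ (+-mono-≤ (scan-≥ js b) (≤-trans (better-≥ b j) (scan-≥ js (better b j)))) ⟩
      𝔼 (scan (j ∷ js) b) w ∎

    module _ (o : Fin n) (L : Carrier) (0≤L : 0# ≤ L)
             (L-least : ∀ {x} → 0# ≤ x → w (just o) ≤ x → L ≤ x) where

      -- In use, `o` owns the item in the optimal allocation and `L` is the positive part of its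
      -- gain, which enters through `0≤L` and `L-least` only.
      charge : Maybe (Fin n) → Carrier
      charge b = if does (≡-dec _≟_ b (just o)) then 0# else L

      charge-≤ : ∀ b → charge b ≤ L
      charge-≤ b with ≡-dec _≟_ b (just o)
      ... | yes _ = 0≤L
      ... | no  _ = ≤-refl

      charge-self : charge (just o) ≡ 0#
      charge-self with o ≟ o
      ... | yes _ = ≡.refl
      ... | no o≢o = contradiction ≡.refl o≢o

      -- A running best that is already as good as `o` pays for `L` in every outcome, since its
      -- worth never drops.
      charge-dominated : ∀ js b → 0# ≤ w b → w (just o) ≤ w b →
                         𝔼 (scan js b) charge ≤ 𝔼 (scan js b) w
      charge-dominated js b 0≤b o≤b = begin
        𝔼 (scan js b) charge    ≤⟨ 𝔼-mono (scan js b) charge-≤ ⟩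
        𝔼 (scan js b) (λ _ → L) ≈⟨ 𝔼-const (scan js b) L ⟩
        L                       ≤⟨ L-least 0≤b o≤b ⟩
        w b                     ≤⟨ scan-≥ js b ⟩
        𝔼 (scan js b) w         ∎

      -- Run on the same coins, the scans from b and from o agree from the first
      -- candidate beating o on; before it, the second one still holds o and is
      -- charged nothing.
      charge-paired : ∀ js b → 0# ≤ w b → w b ≤ w (just o) →
        𝔼 (scan js b) charge + 𝔼 (scan js (just o)) charge ≤
        𝔼 (scan js b) w + 𝔼 (scan js (just o)) w
      charge-paired [] b 0≤b b≤o = begin
        charge b + charge (just o) ≈⟨ +-congˡ (Eq.reflexive charge-self) ⟩
        -- The payments cross over: `w (just o)` bounds both `0#` and itself, hence `L`, and so
        -- covers the charge of `b`, while `w b` only has to cover `0#`.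
        charge b + 0#              ≤⟨ +-mono-≤ (≤-trans (charge-≤ b) (L-least (≤-trans 0≤b b≤o) ≤-refl)) 0≤b ⟩
        w (just o) + w b           ≈⟨ +-comm _ _ ⟩
        w b + w (just o)           ∎
      charge-paired (j ∷ js) b 0≤b b≤o = begin
        ½ * (_ + _) + ½ * (_ + _)   ≈⟨ average-exchange _ _ _ _ ⟩
        ½ * ((_ + _) + (_ + _))     ≤⟨ ½*-mono-≤ (+-mono-≤ (charge-paired js b 0≤b b≤o) heads) ⟩
        ½ * ((_ + _) + (_ + _))     ≈⟨ average-exchange _ _ _ _ ⟨
        ½ * (_ + _) + ½ * (_ + _)   ∎
        where
        heads : 𝔼 (scan js (better b j)) charge + 𝔼 (scan js (better (just o) j)) charge ≤
                𝔼 (scan js (better b j)) w + 𝔼 (scan js (better (just o) j)) w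
        heads with better b j | better-view b j | better (just o) j | better-view (just o) j
        -- Here the two scans merge: both now hold `j`, which beats `o` and pays in each of them.
        ... | _ | replaced b≤j | _ | replaced o≤j = +-mono-≤ (charge-dominated js (just j) (≤-trans 0≤b b≤j) o≤j)
                                                             (charge-dominated js (just j) (≤-trans 0≤b b≤j) o≤j)
        ... | _ | replaced b≤j | _ | kept o≰j     = charge-paired js (just j) (≤-trans 0≤b b≤j) (≰⇒≥ o≰j)
        ... | _ | kept b≰j     | _ | replaced o≤j = contradiction (≤-trans b≤o o≤j) b≰j
        ... | _ | kept b≰j     | _ | kept o≰j     = charge-paired js b 0≤b b≤o

      -- Coins before that of `o` only change the running best. At the coin of `o`, either `o` would
      -- take over, and its two branches are paired, or the running best already dominates `o`.
      charge-≤-worth : ∀ {js} → o ∈ˡ js → ∀ b → 0# ≤ w b → 𝔼 (scan js b) charge ≤ 𝔼 (scan js b) w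
      charge-≤-worth (there {x = j} {xs = js} o∈js) b 0≤b = ½*-mono-≤ (+-mono-≤
        (charge-≤-worth o∈js b 0≤b)
        (charge-≤-worth o∈js (better b j) (≤-trans 0≤b (better-≥ b j))))
      charge-≤-worth (here {xs = js} ≡.refl) b 0≤b with better b o | better-view b o
      ... | _ | replaced b≤o = ½*-mono-≤ (charge-paired js b 0≤b b≤o)
      ... | _ | kept b≰o     = ½*-mono-≤ (+-mono-≤ (charge-dominated js b 0≤b (≰⇒≥ b≰o))
                                                   (charge-dominated js b 0≤b (≰⇒≥ b≰o)))

  better-elim : ∀ {p} (P : Maybe (Fin n) → Set p) w {b} j → P b → P (just j) → P (better w b j)
  better-elim P w {b} j pb pj with better w b j | better-view w b j
  ... | _ | replaced _ = pj
  ... | _ | kept _     = pb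

  module _ (w w′ : Maybe (Fin n) → Carrier) (j : Fin n) (F F′ : Maybe (Fin n) → Carrier) (x : Carrier)
           (bound : ∀ b b′ → b ≢ just j ⊎ b′ ≢ just j → x ≤ F b + F′ b′) where

    -- `F` and `F′` stand for the expected final values of two runs once the current item is placed;
    -- `bound` will come from the induction over the later items, for outcomes in which the runs do
    -- not both select `j`.
    scan-pair : List (Fin n) → Maybe (Fin n) → Maybe (Fin n) → Carrier
    scan-pair js b b′ = 𝔼 (scan w js b) F + 𝔼 (scan w′ js b′) F′

    private
      average-≥ : ∀ {a b c d} → x ≤ a + c → x ≤ b + d → x ≤ ½ * (a + b) + ½ * (c + d)
      average-≥ {a} {b} {c} {d} x≤a+c x≤b+d = begin
        x                           ≈⟨ average-self x ⟨
        ½ * (x + x)                 ≤⟨ ½*-mono-≤ (+-mono-≤ x≤a+c x≤b+d) ⟩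
        ½ * ((a + c) + (b + d))     ≈⟨ average-exchange a b c d ⟨
        ½ * (a + b) + ½ * (c + d)   ∎

    -- Once the coin of `j` is spent, a scan not holding `j` can no longer acquire it. Equal coins
    -- thus preserve that one of the two is free of `j`.
    scan-pair-absent : ∀ {js} → All (j ≢_) js → ∀ b b′ → b ≢ just j ⊎ b′ ≢ just j → x ≤ scan-pair js b b′
    scan-pair-absent []                    b b′ apart = bound b b′ apart
    scan-pair-absent (_∷_ {x = k} j≢k j∉js) b b′ apart = average-≥
      (scan-pair-absent j∉js b b′ apart)
      (scan-pair-absent j∉js (better w b k) (better w′ b′ k) (still-apart apart))
      where
      still-apart : b ≢ just j ⊎ b′ ≢ just j → better w b k ≢ just j ⊎ better w′ b′ k ≢ just j
      still-apart (inj₁ b≢j)  = inj₁ (better-elim (_≢ just j) w k b≢j (j≢k ∘ ≡.sym ∘ just-injective))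
      still-apart (inj₂ b′≢j) = inj₂ (better-elim (_≢ just j) w′ k b′≢j (j≢k ∘ ≡.sym ∘ just-injective))

    -- Couple the two scans by giving them opposite coins for j (and equal
    -- coins for everybody else): then at most one of them selects j.
    scan-pair-≥ : ∀ {js} → Unique js → ∀ b b′ → b ≢ just j → b′ ≢ just j → x ≤ scan-pair js b b′
    scan-pair-≥ []                              b b′ b≢j b′≢j = bound b b′ (inj₁ b≢j)
    scan-pair-≥ (_∷_ {x = k} {xs = js} k∉js uniq) b b′ b≢j b′≢j with k ≟ j
    ... | yes ≡.refl = ≤-trans
      (average-≥ (scan-pair-absent k∉js b (better w′ b′ k) (inj₁ b≢j))
                 (scan-pair-absent k∉js (better w b k) b′ (inj₂ b′≢j)))
      -- Tails of one scan has been matched with heads of the other, so the branches of the second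
      -- flip appear in reverse order.
      (≤-reflexive (+-congˡ (*-congˡ (+-comm _ _))))
    ... | no  k≢j = average-≥
      (scan-pair-≥ uniq b b′ b≢j b′≢j)
      (scan-pair-≥ uniq (better w b k) (better w′ b′ k)
        (better-elim (_≢ just j) w k b≢j (k≢j ∘ just-injective))
        (better-elim (_≢ just j) w′ k b′≢j (k≢j ∘ just-injective)))

-- Set identities and arrival orders

module _ {m : ℕ} where

  ∪-lub : ∀ {A B X : Subset m} → A ⊆ X → B ⊆ X → A ∪ B ⊆ X
  ∪-lub {A} {B} A⊆X B⊆X x∈ = [ A⊆X , B⊆X ]′ (x∈p∪q⁻ A B x∈)

  ⁅⁆⊆ : ∀ {u} {X : Subset m} → u ∈ X → ⁅ u ⁆ ⊆ X
  ⁅⁆⊆ {u} {X} u∈X x∈ = ≡.subst (_∈ X) (≡.sym (x∈⁅y⁆⇒x≡y u x∈)) u∈X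

  ∪-monoˡ-⊆ : ∀ {A B X : Subset m} → A ⊆ B → A ∪ X ⊆ B ∪ X
  ∪-monoˡ-⊆ {A} {B} {X} A⊆B = ∪-lub (⊆-trans A⊆B (p⊆p∪q X)) (q⊆p∪q B X)

  add-∩-fresh : ∀ {u} {A B : Subset m} → u ∉ B → (A ∪ ⁅ u ⁆) ∩ B ≡ A ∩ B
  add-∩-fresh {u} {A} {B} u∉B = ⊆-antisym
    (λ x∈ → let x∈A∪u , x∈B = x∈p∩q⁻ (A ∪ ⁅ u ⁆) B x∈ in
       [ (λ x∈A → x∈p∩q⁺ (x∈A , x∈B))
       , (λ x∈u → contradiction (≡.subst (_∈ B) (x∈⁅y⁆⇒x≡y u x∈u) x∈B) u∉B) ]′ (x∈p∪q⁻ A ⁅ u ⁆ x∈A∪u))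
    (λ x∈ → let x∈A , x∈B = x∈p∩q⁻ A B x∈ in x∈p∩q⁺ (p⊆p∪q ⁅ u ⁆ x∈A , x∈B))

  ∩-add-fresh : ∀ {u} {A B : Subset m} → u ∉ A → A ∩ (B ∪ ⁅ u ⁆) ≡ A ∩ B
  ∩-add-fresh {u} {A} {B} u∉A = ≡.trans (∩-comm A _) (≡.trans (add-∩-fresh u∉A) (∩-comm B A))

  ∩-add : ∀ {u} {A B : Subset m} → u ∈ A → A ∩ (B ∪ ⁅ u ⁆) ≡ (A ∩ B) ∪ ⁅ u ⁆
  ∩-add {u} {A} {B} u∈A = ≡.trans (∩-distribˡ-∪ A B ⁅ u ⁆) (≡.cong ((A ∩ B) ∪_)
    (⊆-antisym (proj₂ ∘ x∈p∩q⁻ A ⁅ u ⁆) (λ x∈ → x∈p∩q⁺ (⁅⁆⊆ u∈A x∈ , x∈))))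

  -- Distinctness of the arrivals, unfolded along the growing set `X` of arrived items, which is how
  -- the inductions over arrivals consume it.
  Fresh : List (Fin m) → Subset m → Set
  Fresh []       X = Unit.⊤
  Fresh (u ∷ us) X = u ∉ X × Fresh us (X ∪ ⁅ u ⁆)

  unique⇒fresh : ∀ {us X} → Unique us → All (_∉ X) us → Fresh us X
  unique⇒fresh             []             []           = Unit.tt
  unique⇒fresh {u ∷ us} {X} (u∉us ∷ uniq) (u∉X ∷ us∉X) = u∉X , unique⇒fresh uniq
    (All.zipWith (λ { (u≢v , v∉X) → [ v∉X , (λ v∈u → u≢v (≡.sym (x∈⁅y⁆⇒x≡y u v∈u))) ]′ ∘ x∈p∪q⁻ X ⁅ u ⁆ })
                 (u∉us , us∉X))

  arrivals : Permutation′ m → List (Fin m)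
  arrivals π = List.tabulate (π ⟨$⟩ʳ_)

  arrivals-fresh : ∀ π → Fresh (arrivals π) ⊥
  arrivals-fresh π = unique⇒fresh
    (tabulate⁺ λ {i} {j} πi≡πj → ≡.trans (≡.sym (inverseˡ π)) (≡.trans (≡.cong (π ⟨$⟩ˡ_) πi≡πj) (inverseˡ π)))
    (All.universal (λ _ → ∉⊥) _)

  arrived-after : List (Fin m) → Subset m → Subset m
  arrived-after us X = List.foldl (λ X u → X ∪ ⁅ u ⁆) X us

  arrived-after-⊇ : ∀ us X → X ⊆ arrived-after us X
  arrived-after-⊇ []       X = ⊆-refl
  arrived-after-⊇ (u ∷ us) X = ⊆-trans (p⊆p∪q ⁅ u ⁆) (arrived-after-⊇ us (X ∪ ⁅ u ⁆))

  ∈-arrived-after : ∀ {us u} X → u ∈ˡ us → u ∈ arrived-after us X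
  ∈-arrived-after {u ∷ us} X (here ≡.refl) = arrived-after-⊇ us (X ∪ ⁅ u ⁆) (q⊆p∪q X ⁅ u ⁆ (x∈⁅x⁆ u))
  ∈-arrived-after {v ∷ us} X (there u∈us) = ∈-arrived-after (X ∪ ⁅ v ⁆) u∈us

  arrivals-exhaustive : ∀ π → arrived-after (arrivals π) ⊥ ≡ ⊤
  arrivals-exhaustive π = ⊆-antisym ⊆⊤
    (λ {u} _ → ∈-arrived-after ⊥ (≡.subst (_∈ˡ arrivals π) (inverseʳ π) (∈-tabulate⁺ (π ⟨$⟩ˡ u))))

-- Disjoint allocations and their updates

module _ {m : ℕ} where

  disjoint-lookup : ∀ {n} {O : Allocation n m} → PairwiseDisjoint O →
                    ∀ {i j u} → i ≢ j → u ∈ lookup O i → u ∉ lookup O j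
  disjoint-lookup (A∩O ∷ _)    {zero}  {zero}  i≢j u∈A u∈B = i≢j ≡.refl
  disjoint-lookup (A∩O ∷ _)    {zero}  {suc j} i≢j u∈A u∈B = AllV.lookup⁺ A∩O j (_ , x∈p∩q⁺ (u∈A , u∈B))
  disjoint-lookup (A∩O ∷ _)    {suc i} {zero}  i≢j u∈A u∈B = AllV.lookup⁺ A∩O i (_ , x∈p∩q⁺ (u∈B , u∈A))
  disjoint-lookup (_ ∷ disj)   {suc i} {suc j} i≢j = disjoint-lookup disj (i≢j ∘ ≡.cong suc)

module _ {n m : ℕ} where

  allocate : Maybe (Fin n) → Fin m → Allocation n m → Allocation n m
  allocate nothing  u S = S
  allocate (just j) u S = updateAt S j (_∪ ⁅ u ⁆)

  lookup-allocate-self : ∀ {j u} S → lookup (allocate (just j) u S) j ≡ lookup S j ∪ ⁅ u ⁆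
  lookup-allocate-self {j} S = lookup∘updateAt j S

  lookup-allocate-other : ∀ {b j u} S → b ≢ just j → lookup (allocate b u S) j ≡ lookup S j
  lookup-allocate-other {nothing}    S b≢j = ≡.refl
  lookup-allocate-other {just k} {j} S k≢j = lookup∘updateAt′ j k (k≢j ∘ ≡.cong just ∘ ≡.sym) S

  lookup-allocate-⊆ : ∀ b {u j S X} → lookup S j ⊆ X → lookup (allocate b u S) j ⊆ X ∪ ⁅ u ⁆
  lookup-allocate-⊆ b {u} {j} {S} {X} S⊆X with ≡-dec _≟_ b (just j)
  ... | yes ≡.refl rewrite lookup-allocate-self {j} {u} S         = ∪-monoˡ-⊆ S⊆X
  ... | no  b≢j    rewrite lookup-allocate-other {u = u} S b≢j    = ⊆-trans S⊆X (p⊆p∪q ⁅ u ⁆)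

-- The greedy algorithm and its competitive ratio

module Greedy {c ℓ₁ ℓ₂} (K : OrderedField c ℓ₁ ℓ₂) {n m : ℕ} (I : OnlineWelfare.Instance K n m) where

  open OrderedField K
  open OrderedFieldProperties K
  open OnlineWelfare K
  open Expectation K
  open Auction K {n}

  worth : Allocation n m → Fin m → Maybe (Fin n) → Carrier
  worth S u nothing  = 0#
  worth S u (just j) = utility I j (lookup S j ∪ ⁅ u ⁆) - utility I j (lookup S j)

  bidders : List (Fin n)
  bidders = below n ℕ.≤-refl

  auction : Fin m → Allocation n m → Comp (Maybe (Fin n))
  auction u S = scan (worth S u) bidders nothing

  -- A model free of registers and ticks; the machine is later shown to follow it coin for coin.
  greedy : List (Fin m) → Allocation n m → Comp (Allocation n m)
  greedy []       S = return S
  greedy (u ∷ us) S = auction u S >>= λ b → greedy us (allocate b u S)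

  module _ (j : Fin n) (Q : Subset m) where

    private
      f = utility I j
      h : Allocation n m → Carrier
      h T = f (lookup T j ∪ Q)

    -- Coupled runs diverge, so the induction is over two allocations. With opposite coins for `j`
    -- the meet of the two sets of `j` never changes; at the end, submodularity bounds the value of
    -- the meet and non-negativity discards that of the join.
    greedy-pair-≥ : ∀ {us X S S′} → Fresh us X → lookup S j ⊆ X → lookup S′ j ⊆ X →
      f ((lookup S j ∩ lookup S′ j) ∪ Q) ≤ 𝔼 (greedy us S) h + 𝔼 (greedy us S′) h
    greedy-pair-≥ {[]} {X} {S} {S′} _ _ _ = begin
      f ((A ∩ B) ∪ Q)                                  ≡⟨ ≡.cong f (∪-distribʳ-∩ Q A B) ⟩
      f ((A ∪ Q) ∩ (B ∪ Q))                            ≈⟨ +-identityˡ _ ⟨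
      0# + f ((A ∪ Q) ∩ (B ∪ Q))                       ≤⟨ +-mono-≤ (nonNegative I j _) ≤-refl ⟩
      f ((A ∪ Q) ∪ (B ∪ Q)) + f ((A ∪ Q) ∩ (B ∪ Q))    ≤⟨ submodular I j (A ∪ Q) (B ∪ Q) ⟩
      f (A ∪ Q) + f (B ∪ Q)                            ∎
      where
      A = lookup S j
      B = lookup S′ j
    greedy-pair-≥ {u ∷ us} {X} {S} {S′} (u∉X , fresh) S⊆X S′⊆X = begin
      f ((A ∩ B) ∪ Q)
        ≤⟨ scan-pair-≥ (worth S u) (worth S′ u) j (F S) (F S′) _ bound (below-unique n ℕ.≤-refl) nothing nothing
             (λ ()) (λ ()) ⟩
      𝔼 (auction u S) (F S) + 𝔼 (auction u S′) (F S′)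
        ≈⟨ +-cong (𝔼->>= (auction u S) _ h) (𝔼->>= (auction u S′) _ h) ⟨
      𝔼 (greedy (u ∷ us) S) h + 𝔼 (greedy (u ∷ us) S′) h ∎
      where
      A = lookup S j
      B = lookup S′ j
      F : Allocation n m → Maybe (Fin n) → Carrier
      F T b = 𝔼 (greedy us (allocate b u T)) h

      -- At most one run gives `u` to `j`, and `u` is missing from the set of `j` in the other run.
      unchanged : ∀ b b′ → b ≢ just j ⊎ b′ ≢ just j →
                  lookup (allocate b u S) j ∩ lookup (allocate b′ u S′) j ≡ A ∩ B
      unchanged b b′ apart with ≡-dec _≟_ b (just j) | ≡-dec _≟_ b′ (just j)
      ... | yes b≡j    | yes b′≡j   = contradiction apart λ { (inj₁ b≢j) → b≢j b≡j ; (inj₂ b′≢j) → b′≢j b′≡j }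
      ... | yes ≡.refl | no b′≢j
        rewrite lookup-allocate-self {j = j} {u} S | lookup-allocate-other {u = u} S′ b′≢j = add-∩-fresh (u∉X ∘ S′⊆X)
      ... | no b≢j     | yes ≡.refl
        rewrite lookup-allocate-other {u = u} S b≢j | lookup-allocate-self {j = j} {u} S′ = ∩-add-fresh (u∉X ∘ S⊆X)
      ... | no b≢j     | no b′≢j    =
        ≡.cong₂ _∩_ (lookup-allocate-other S b≢j) (lookup-allocate-other S′ b′≢j)

      bound : ∀ b b′ → b ≢ just j ⊎ b′ ≢ just j → f ((A ∩ B) ∪ Q) ≤ F S b + F S′ b′
      bound b b′ apart = ≡.subst (λ C → f (C ∪ Q) ≤ F S b + F S′ b′) (unchanged b b′ apart)
        (greedy-pair-≥ {S = allocate b u S} {S′ = allocate b′ u S′} fresh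
          (lookup-allocate-⊆ b {S = S} S⊆X) (lookup-allocate-⊆ b′ {S = S′} S′⊆X))

  -- Diminishing returns: submodularity for `A ∪ ⁅ u ⁆` and `A ∪ B`, which meet in `A` because `u`
  -- lies in neither `A` nor `B`.
  marginal-≤ : ∀ j {u A B} → u ∉ A → u ∉ B →
    utility I j ((A ∪ B) ∪ ⁅ u ⁆) ≤ utility I j (A ∪ ⁅ u ⁆) - utility I j A + utility I j (A ∪ B)
  marginal-≤ j {u} {A} {B} u∉A u∉B = ≤-from crossed
    (Eq.trans (+-congˡ (+-congʳ (Eq.sym (x-y+y≈x (f (A ∪ ⁅ u ⁆)) (f A)))))
      (solve 4 (λ a g x b → a :+ ((g :+ x) :+ b) := g :+ b :+ (a :+ x)) Eq.refl
         (f ((A ∪ B) ∪ ⁅ u ⁆)) (f (A ∪ ⁅ u ⁆) - f A) (f A) (f (A ∪ B))))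
    where
    f = utility I j
    u∉A∪B : u ∉ A ∪ B
    u∉A∪B u∈ = [ u∉A , u∉B ]′ (x∈p∪q⁻ A B u∈)
    join : (A ∪ ⁅ u ⁆) ∪ (A ∪ B) ≡ (A ∪ B) ∪ ⁅ u ⁆
    join = ⊆-antisym
      (∪-lub (∪-monoˡ-⊆ (p⊆p∪q B)) (p⊆p∪q ⁅ u ⁆))
      (∪-lub (q⊆p∪q (A ∪ ⁅ u ⁆) (A ∪ B)) (⊆-trans (q⊆p∪q A ⁅ u ⁆) (p⊆p∪q (A ∪ B))))
    meet : (A ∪ ⁅ u ⁆) ∩ (A ∪ B) ≡ A
    meet = ≡.trans (add-∩-fresh u∉A∪B) (⊆-antisym (proj₁ ∘ x∈p∩q⁻ A (A ∪ B)) (λ x∈A → x∈p∩q⁺ (x∈A , p⊆p∪q B x∈A)))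
    crossed : f ((A ∪ B) ∪ ⁅ u ⁆) + f A ≤ f (A ∪ ⁅ u ⁆) + f (A ∪ B)
    crossed = ≡.subst₂ (λ C D → f C + f D ≤ f (A ∪ ⁅ u ⁆) + f (A ∪ B)) join meet (submodular I j (A ∪ ⁅ u ⁆) (A ∪ B))

  module _ (u : Fin m) (S : Allocation n m) where

    -- Spreads the gain of the auction over the bidders, so that it can be added inside the sums
    -- over bidders.
    payment : Maybe (Fin n) → Fin n → Carrier
    payment b j = if does (≡-dec _≟_ b (just j)) then worth S u (just j) else 0#

    sum-payment : ∀ b → sum (payment b) ≈ worth S u b
    sum-payment nothing  = sum-zero {t = payment nothing} λ _ → Eq.refl
    sum-payment (just k) = Eq.trans (sum-single (payment (just k)) k others) self
      where
      others : ∀ j → j ≢ k → payment (just k) j ≈ 0#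
      others j j≢k with k ≟ j
      ... | yes k≡j = contradiction (≡.sym k≡j) j≢k
      ... | no  _   = Eq.refl
      self : payment (just k) k ≈ worth S u (just k)
      self with k ≟ k
      ... | yes _   = Eq.refl
      ... | no  k≢k = contradiction ≡.refl k≢k

    utility-allocate : ∀ b j → utility I j (lookup (allocate b u S) j) ≈ utility I j (lookup S j) + payment b j
    utility-allocate b j with ≡-dec _≟_ b (just j)
    ... | yes ≡.refl rewrite lookup-allocate-self {j = j} {u} S      = Eq.sym (Eq.trans (+-comm _ _) (x-y+y≈x _ _))
    ... | no  b≢j    rewrite lookup-allocate-other {u = u} S b≢j = Eq.sym (+-identityʳ _)

    welfare-allocate : ∀ b → welfare I (allocate b u S) ≈ welfare I S + worth S u b
    welfare-allocate b = begin-equality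
      sum (λ j → utility I j (lookup (allocate b u S) j))       ≈⟨ sum-cong-≋ (utility-allocate b) ⟩
      sum (λ j → utility I j (lookup S j) + payment b j)        ≈⟨ ∑-distrib-+ _ (payment b) ⟩
      welfare I S + sum (payment b)                             ≈⟨ +-congˡ (sum-payment b) ⟩
      welfare I S + worth S u b                                 ∎

  module _ (O : Allocation n m) (O-disjoint : PairwiseDisjoint O) where

    -- With `X` the set of arrived items, this moves from the welfare of `T` itself at `⊥` to the
    -- welfare of `T` joined with `O` at `⊤`.
    merged : Allocation n m → Subset m → Carrier
    merged T X = sum (λ j → utility I j (lookup T j ∪ (lookup O j ∩ X)))

    module _ (u : Fin m) (S : Allocation n m) where

      lost : Fin n → Maybe (Fin n) → Carrier
      lost j = charge (worth S u) j (worth S u (just j) ⁺) (0≤x⁺ _) (⁺-least _)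

      -- Indexed by all bidders to fit under a sum; disjointness of `O` leaves at most one nonzero
      -- entry, that of the owner of `u`.
      loss : Maybe (Fin n) → Fin n → Carrier
      loss b j = if does (u ∈? lookup O j) then lost j b else 0#

      -- Only the selected bidder and the owner of `u` in `O` see their merged sets grow. By
      -- diminishing returns the growth costs at most the marginal gain over the bidder's own set,
      -- paid by `payment` or by `loss`.
      merged-step : ∀ {X} → u ∉ X → (∀ j → lookup S j ⊆ X) → ∀ b →
        merged (allocate b u S) (X ∪ ⁅ u ⁆) ≤ worth S u b + merged S X + sum (loss b)
      merged-step {X} u∉X S⊆X b = begin
        merged (allocate b u S) (X ∪ ⁅ u ⁆)
          ≤⟨ sum-mono-≤ step ⟩
        sum (λ j → payment u S b j + utility I j (lookup S j ∪ (lookup O j ∩ X)) + loss b j)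
          ≈⟨ ∑-distrib-+ _ (loss b) ⟩
        sum (λ j → payment u S b j + utility I j (lookup S j ∪ (lookup O j ∩ X))) + sum (loss b)
          ≈⟨ +-congʳ (∑-distrib-+ (payment u S b) _) ⟩
        sum (payment u S b) + merged S X + sum (loss b)
          ≈⟨ +-congʳ (+-congʳ (sum-payment u S b)) ⟩
        worth S u b + merged S X + sum (loss b) ∎
        where
        step : ∀ j → utility I j (lookup (allocate b u S) j ∪ (lookup O j ∩ (X ∪ ⁅ u ⁆))) ≤
                     payment u S b j + utility I j (lookup S j ∪ (lookup O j ∩ X)) + loss b j
        step j = main
          where
          f = utility I j
          A = lookup S j
          B = lookup O j ∩ X
          u∉A : u ∉ A
          u∉A = u∉X ∘ S⊆X j
          u∉B : u ∉ B
          u∉B = u∉X ∘ proj₂ ∘ x∈p∩q⁻ (lookup O j) X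
          marginal : f ((A ∪ B) ∪ ⁅ u ⁆) ≤ worth S u (just j) + f (A ∪ B)
          marginal = marginal-≤ j u∉A u∉B
          marginal+0 : f ((A ∪ B) ∪ ⁅ u ⁆) ≤ worth S u (just j) + f (A ∪ B) + 0#
          marginal+0 = ≤-respʳ-≈ (Eq.sym (+-identityʳ _)) marginal
          same : (A ∪ ⁅ u ⁆) ∪ (B ∪ ⁅ u ⁆) ≡ (A ∪ B) ∪ ⁅ u ⁆
          same = ⊆-antisym
            (∪-lub (∪-monoˡ-⊆ (p⊆p∪q B)) (∪-monoˡ-⊆ (q⊆p∪q A B)))
            (∪-lub (∪-lub (⊆-trans (p⊆p∪q _) (p⊆p∪q _)) (⊆-trans (p⊆p∪q _) (q⊆p∪q _ _)))
                   (⊆-trans (q⊆p∪q A _) (p⊆p∪q _)))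
          swap : (A ∪ ⁅ u ⁆) ∪ B ≡ (A ∪ B) ∪ ⁅ u ⁆
          swap = ≡.trans (∪-assoc A ⁅ u ⁆ B) (≡.trans (≡.cong (A ∪_) (∪-comm ⁅ u ⁆ B)) (≡.sym (∪-assoc A B ⁅ u ⁆)))
          main : f (lookup (allocate b u S) j ∪ (lookup O j ∩ (X ∪ ⁅ u ⁆))) ≤ payment u S b j + f (A ∪ B) + loss b j
          -- `payment` and `loss` branch on these same two decisions and reduce along with the
          -- allocation.
          main with ≡-dec _≟_ b (just j) | u ∈? lookup O j
          -- An owner who is selected is charged nothing: `u` enters its merged set once and
          -- `payment` covers it.
          ... | yes ≡.refl | yes u∈O
            rewrite lookup-allocate-self {j = j} {u} S | ∩-add {B = X} u∈O | same = marginal+0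
          ... | yes ≡.refl | no u∉O
            rewrite lookup-allocate-self {j = j} {u} S | ∩-add-fresh {B = X} u∉O | swap = marginal+0
          ... | no b≢j | yes u∈O
            rewrite lookup-allocate-other {u = u} S b≢j | ∩-add {B = X} u∈O | ≡.sym (∪-assoc A B ⁅ u ⁆) = begin
              f ((A ∪ B) ∪ ⁅ u ⁆)                           ≤⟨ marginal ⟩
              worth S u (just j) + f (A ∪ B)                ≤⟨ +-mono-≤ (x≤x⁺ _) ≤-refl ⟩
              worth S u (just j) ⁺ + f (A ∪ B)              ≈⟨ solve 2 (λ x y → x :+ y := con 0 :+ y :+ x) Eq.refl _ _ ⟩
              0# + f (A ∪ B) + worth S u (just j) ⁺         ∎
          ... | no b≢j | no u∉O
            rewrite lookup-allocate-other {u = u} S b≢j | ∩-add-fresh {B = X} u∉O =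
              ≤-reflexive (solve 1 (λ x → x := con 0 :+ x :+ con 0) Eq.refl _)

      -- If `u` has an owner, the total loss is that owner's charge, which the auction covers.
      -- Otherwise it is zero, and an auction that may discard has non-negative expected worth.
      loss-≤-worth : 𝔼 (auction u S) (λ b → sum (loss b)) ≤ 𝔼 (auction u S) (worth S u)
      loss-≤-worth with any? (λ j → u ∈? lookup O j)
      ... | yes (o , u∈O) = begin
        𝔼 (auction u S) (λ b → sum (loss b)) ≈⟨ 𝔼-cong (auction u S)
                                                  (λ b → Eq.trans (sum-single (loss b) o (others b)) (self b)) ⟩
        𝔼 (auction u S) (lost o)             ≤⟨ charge-≤-worth (worth S u) o _ (0≤x⁺ _) (⁺-least _)
                                                  (∈-below n ℕ.≤-refl (toℕ<n o)) nothing ≤-refl ⟩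
        𝔼 (auction u S) (worth S u)          ∎
        where
        others : ∀ b j → j ≢ o → loss b j ≈ 0#
        others b j j≢o with u ∈? lookup O j
        ... | yes u∈Oj = contradiction u∈Oj (disjoint-lookup O-disjoint (j≢o ∘ ≡.sym) u∈O)
        ... | no  _    = Eq.refl
        self : ∀ b → loss b o ≈ lost o b
        self b with u ∈? lookup O o
        ... | yes _   = Eq.refl
        ... | no u∉O  = contradiction u∈O u∉O
      ... | no unowned = begin
        𝔼 (auction u S) (λ b → sum (loss b)) ≈⟨ 𝔼-cong (auction u S) (λ b → sum-zero (none b)) ⟩
        𝔼 (auction u S) (λ b → 0#)           ≈⟨ 𝔼-const (auction u S) 0# ⟩
        0#                                   ≤⟨ scan-≥ (worth S u) bidders nothing ⟩
        𝔼 (auction u S) (worth S u)          ∎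
        where
        none : ∀ b j → loss b j ≈ 0#
        none b j with u ∈? lookup O j
        ... | yes u∈Oj = contradiction (j , u∈Oj) unowned
        ... | no  _    = Eq.refl

    -- Twice the welfare minus `merged` is a submartingale along the run; its current and expected
    -- final values are compared here without subtraction.
    merged-≤-welfare : ∀ us {X} S → Fresh us X → (∀ j → lookup S j ⊆ X) →
      𝔼 (greedy us S) (λ T → merged T (arrived-after us X)) + (welfare I S + welfare I S) ≤
      𝔼 (greedy us S) (welfare I) + 𝔼 (greedy us S) (welfare I) + merged S X
    merged-≤-welfare [] S _ _ = ≤-reflexive (+-comm _ _)
    merged-≤-welfare (u ∷ us) {X} S (u∉X , fresh) S⊆X = ≤-from (+-mono-≤ averaged (loss-≤-worth u S))
      (Eq.trans
        (+-congʳ (+-congʳ (𝔼->>= p _ _)))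
        (Eq.trans
          (solve 6 (λ x w v m l g → (x :+ (w :+ w)) :+ ((v :+ v :+ m :+ l) :+ g) := (v :+ v :+ m) :+ ((x :+ (w :+ w) :+ g) :+ l))
            Eq.refl (𝔼 p EM) (welfare I S) (𝔼 p EW) (merged S X) (𝔼 p (λ b → sum (loss u S b))) (𝔼 p (worth S u)))
          (+-congʳ (+-congʳ (+-cong (Eq.sym (𝔼->>= p _ _)) (Eq.sym (𝔼->>= p _ _)))))))
      where
      p = auction u S
      S′ : Maybe (Fin n) → Allocation n m
      S′ b = allocate b u S
      EM EW : Maybe (Fin n) → Carrier
      EM b = 𝔼 (greedy us (S′ b)) (λ T → merged T (arrived-after us (X ∪ ⁅ u ⁆)))
      EW b = 𝔼 (greedy us (S′ b)) (welfare I)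
      ww = welfare I S + welfare I S

      pointwise : ∀ b → EM b + ww + worth S u b ≤ EW b + EW b + merged S X + sum (loss u S b)
      -- The induction hypothesis contains the gain of the selected bidder twice. One copy pays for
      -- `merged-step`; the other stays on the left, to be set against the loss after averaging.
      pointwise b = ≤-from
        (+-mono-≤ (merged-≤-welfare us (S′ b) fresh (λ j → lookup-allocate-⊆ b {S = S} (S⊆X j))) (merged-step u S u∉X S⊆X b))
        (Eq.trans
          (solve 7 (λ x w g v m l m′ → (x :+ (w :+ w) :+ g) :+ (((v :+ v) :+ m′) :+ (g :+ m :+ l))
              := (v :+ v :+ m :+ l) :+ ((x :+ ((w :+ g) :+ (w :+ g))) :+ m′)) Eq.refl
             (EM b) (welfare I S) (worth S u b) (EW b) (merged S X) (sum (loss u S b)) (merged (S′ b) (X ∪ ⁅ u ⁆)))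
          (+-congˡ (+-congʳ (+-congˡ (Eq.sym (+-cong (welfare-allocate u S b) (welfare-allocate u S b)))))))

      averaged : 𝔼 p EM + ww + 𝔼 p (worth S u) ≤ 𝔼 p EW + 𝔼 p EW + merged S X + 𝔼 p (λ b → sum (loss u S b))
      averaged = begin
        𝔼 p EM + ww + 𝔼 p (worth S u)
          ≈⟨ +-congʳ (Eq.trans (𝔼-+ p EM (λ _ → ww)) (+-congˡ (𝔼-const p ww))) ⟨
        𝔼 p (λ b → EM b + ww) + 𝔼 p (worth S u)
          ≈⟨ 𝔼-+ p (λ b → EM b + ww) (worth S u) ⟨
        𝔼 p (λ b → EM b + ww + worth S u b)
          ≤⟨ 𝔼-mono p pointwise ⟩
        𝔼 p (λ b → EW b + EW b + merged S X + sum (loss u S b))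
          ≈⟨ 𝔼-+ p (λ b → EW b + EW b + merged S X) (λ b → sum (loss u S b)) ⟩
        𝔼 p (λ b → EW b + EW b + merged S X) + 𝔼 p (λ b → sum (loss u S b))
          ≈⟨ +-congʳ (Eq.trans (𝔼-+ p (λ b → EW b + EW b) (λ _ → merged S X)) (+-cong (𝔼-+ p EW EW) (𝔼-const p _))) ⟩
        𝔼 p EW + 𝔼 p EW + merged S X + 𝔼 p (λ b → sum (loss u S b)) ∎

    greedy-competitive : ∀ π → ¼ * welfare I O ≤ 𝔼 (greedy (arrivals π) nothing-allocated) (welfare I)
    greedy-competitive π = begin
      ¼ * welfare I O               ≈⟨ *-congʳ ½½≈¼ ⟨
      ½ * ½ * welfare I O           ≈⟨ *-assoc ½ ½ _ ⟩
      -- One factor `½` is spent on passing from `O` to the merged allocation, by coupling, and the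
      -- other on passing from there to the welfare of the run.
      ½ * (½ * welfare I O)         ≤⟨ ½*-mono-≤ (½*-mono-≤ O≤2M) ⟩
      ½ * (½ * (EM + EM))           ≈⟨ *-congˡ (average-self EM) ⟩
      ½ * EM                        ≤⟨ ½*-mono-≤ M≤2W ⟩
      ½ * (EW + EW)                 ≈⟨ average-self EW ⟩
      EW                            ∎
      where
      us = arrivals π
      ∅ : Allocation n m
      ∅ = nothing-allocated
      p = greedy us ∅
      EM = 𝔼 p (λ T → merged T ⊤)
      EW = 𝔼 p (welfare I)
      ∅≡⊥ : ∀ j → lookup ∅ j ≡ ⊥
      ∅≡⊥ j = lookup-replicate j ⊥
      ∅⊆⊥ : ∀ j → lookup ∅ j ⊆ ⊥
      ∅⊆⊥ j x∈ = ≡.subst (_ ∈_) (∅≡⊥ j) x∈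

      merged-initially : merged ∅ ⊥ ≈ welfare I ∅
      merged-initially = sum-cong-≋ (λ j → Eq.reflexive (≡.cong (utility I j)
        (≡.trans (≡.cong (lookup ∅ j ∪_) (≡.trans (∩-zeroʳ (lookup O j)) (≡.sym (∅≡⊥ j)))) (∪-idem (lookup ∅ j)))))

      0≤welfare : 0# ≤ welfare I ∅
      0≤welfare = ≤-respˡ-≈ (sum-zero {n} {λ _ → 0#} (λ _ → Eq.refl)) (sum-mono-≤ (λ j → nonNegative I j _))

      M≤2W : EM ≤ EW + EW
      -- Initially `merged` equals the welfare of the empty allocation, which need not be zero; one
      -- copy of it is left over and dropped as non-negative.
      M≤2W = ≤-from
        (+-mono-≤ (≡.subst (λ X → 𝔼 p (λ T → merged T X) + (welfare I ∅ + welfare I ∅) ≤ EW + EW + merged ∅ ⊥)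
                     (arrivals-exhaustive π) (merged-≤-welfare us ∅ (arrivals-fresh π) ∅⊆⊥))
                  0≤welfare)
        (Eq.trans (+-congˡ (+-congʳ (+-congˡ merged-initially)))
          (solve 3 (λ x v w → x :+ (((v :+ v) :+ w) :+ w) := (v :+ v) :+ ((x :+ (w :+ w)) :+ con 0)) Eq.refl EM EW (welfare I ∅)))

      O≤2M : welfare I O ≤ EM + EM
      O≤2M = begin
        welfare I O                           ≤⟨ sum-mono-≤ per-bidder ⟩
        sum (λ j → 𝔼 p (h j) + 𝔼 p (h j))     ≈⟨ ∑-distrib-+ (λ j → 𝔼 p (h j)) (λ j → 𝔼 p (h j)) ⟩
        sum (λ j → 𝔼 p (h j)) + sum (λ j → 𝔼 p (h j)) ≈⟨ +-cong (𝔼-sum p h) (𝔼-sum p h) ⟨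
        EM + EM                               ∎
        where
        h : Fin n → Allocation n m → Carrier
        h j T = utility I j (lookup T j ∪ (lookup O j ∩ ⊤))
        O-initially : ∀ j → (lookup ∅ j ∩ lookup ∅ j) ∪ (lookup O j ∩ ⊤) ≡ lookup O j
        O-initially j = ≡.trans (≡.cong₂ _∪_ (≡.trans (∩-idem _) (∅≡⊥ j)) (∩-identityʳ _)) (∪-identityˡ _)
        per-bidder : ∀ j → utility I j (lookup O j) ≤ 𝔼 p (h j) + 𝔼 p (h j)
        per-bidder j = ≡.subst (λ C → utility I j C ≤ 𝔼 p (h j) + 𝔼 p (h j)) (O-initially j)
          -- Both coupled runs start empty-handed, so the same expectation appears twice.
          (greedy-pair-≥ j (lookup O j ∩ ⊤) (arrivals-fresh π) (∅⊆⊥ j) (∅⊆⊥ j))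

-- Refinement of coin trees

-- Refines R t p q: p runs in time at most t, and on the same coins p and q
-- produce results related by R.
data Refines {a b r} {A : Set a} {B : Set b} (R : A → B → Set r) : ℕ → Comp A → Comp B → Set (a ⊔ b ⊔ r) where
  return : ∀ {t x y} → R x y → Refines R t (return x) (return y)
  tick   : ∀ {t p q} → Refines R t p q → Refines R (suc t) (tick p) q
  flip   : ∀ {t p p′ q q′} → Refines R t p q → Refines R t p′ q′ → Refines R t (flip p p′) (flip q q′)

>>=-identityʳ : ∀ {a} {A : Set a} (p : Comp A) → (p >>= return) ≡ p
>>=-identityʳ (return x) = ≡.refl
>>=-identityʳ (tick p)   = ≡.cong tick (>>=-identityʳ p)
>>=-identityʳ (flip p q) = ≡.cong₂ flip (>>=-identityʳ p) (>>=-identityʳ q)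

module _ {a b r} {A : Set a} {B : Set b} {R : A → B → Set r} where

  weaken : ∀ {t t′ p q} → t ℕ.≤ t′ → Refines R t p q → Refines R t′ p q
  weaken t≤t′           (return xRy) = return xRy
  weaken (ℕ.s≤s t≤t′) (tick ref)     = tick (weaken t≤t′ ref)
  weaken t≤t′           (flip ref ref′) = flip (weaken t≤t′ ref) (weaken t≤t′ ref′)

module _ {a b r} {A : Set a} {B : Set b} {R : A → B → Set r} where

  refines-time : ∀ {t p q} → Refines R t p q → time p ℕ.≤ t
  refines-time (return _)      = ℕ.z≤n
  refines-time (tick ref)      = ℕ.s≤s (refines-time ref)
  refines-time (flip ref ref′) = ℕ.⊔-lub (refines-time ref) (refines-time ref′)

  refines->>= : ∀ {c d s} {C : Set c} {D : Set d} {Q : C → D → Set s} {t t′ p q} {k : A → Comp C} {l : B → Comp D} →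
    Refines R t p q → (∀ {x y} → R x y → Refines Q t′ (k x) (l y)) → Refines Q (t ℕ.+ t′) (p >>= k) (q >>= l)
  refines->>= (return xRy)    cont = weaken (ℕ.m≤n+m _ _) (cont xRy)
  refines->>= (tick ref)      cont = tick (refines->>= ref cont)
  refines->>= (flip ref ref′) cont = flip (refines->>= ref cont) (refines->>= ref′ cont)

  refines-if : ∀ {ℓ t p p′ q} {P : Set ℓ} (d : Dec P) → (P → Refines R t p q) → (¬ P → Refines R t p′ q) →
    Refines R t (if does d then p else p′) q
  refines-if (yes holds) then-ref else-ref = then-ref holds
  refines-if (no  fails) then-ref else-ref = else-ref fails

module _ {c ℓ₁ ℓ₂} (K : OrderedField c ℓ₁ ℓ₂) where

  open OrderedField K
  open OrderedFieldProperties K using (module Eq; +-cong; *-congˡ)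
  open OnlineWelfare K using (𝔼)

  refines-𝔼 : ∀ {a} {A : Set a} {t} {p q : Comp A} → Refines _≡_ t p q → ∀ v → 𝔼 p v ≈ 𝔼 q v
  refines-𝔼 (return ≡.refl) v = Eq.refl
  refines-𝔼 (tick ref)      v = refines-𝔼 ref v
  refines-𝔼 (flip ref ref′) v = *-congˡ (+-cong (refines-𝔼 ref v) (refines-𝔼 ref′ v))

-- The machine program

row-reg one-reg coin-reg zero-reg bidder-reg best-reg with-reg without-reg gain-reg : ℕ
row-reg     = 3
one-reg     = 4
coin-reg    = 5
zero-reg    = 6
bidder-reg  = 7
-- From here on the numbers name field registers, which are separate from the index registers with
-- the same numbers.
best-reg    = 0
with-reg    = 1
without-reg = 2
gain-reg    = 3

measure consider prepare sample-greedy : Program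

-- The item is written into the bidder's row for the second query only and erased again.
measure =
  subᵢ bidder-reg row-reg one-reg ⨾
  query without-reg bidder-reg row-reg ⨾
  storeᵢ row-reg item-reg one-reg ⨾
  query with-reg bidder-reg row-reg ⨾
  storeᵢ row-reg item-reg zero-reg ⨾
  arith sub gain-reg with-reg without-reg

-- Subtracting `zero-reg` copies an index register; repeating the subtraction of the oracle values
-- copies the gain.
consider =
  coin coin-reg ⨾
  (if one-reg ≤ᵢ coin-reg then
    (if best-reg ≤ₖ gain-reg then
      subᵢ output-reg row-reg zero-reg ⨾
      arith sub best-reg with-reg without-reg
    else skip)
  else skip) ⨾
  subᵢ row-reg row-reg one-reg

-- Data persists between arrivals, so the scan is reset to the discard option: output 0, worth `0#`.
prepare =
  setᵢ output-reg 0 ⨾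
  setᵢ one-reg 1 ⨾
  setᵢ zero-reg 0 ⨾
  subᵢ row-reg bidders-reg zero-reg ⨾
  set0 best-reg

-- The items of bidder j are kept in row suc j, so that an output value is
-- the row to be updated; row 0 collects the discarded items.
sample-greedy =
  prepare ⨾
  loop bidders-reg (measure ⨾ consider) ⨾
  storeᵢ output-reg item-reg one-reg

-- Memory updates and the representation of allocations

module _ {a} {A : Set a} where

  ↦-same : ∀ (g : ℕ → A) x {v} → (g [ x ↦ v ]) x ≡ v
  ↦-same g x {v} = ≡.cong (if_then v else g x) (dec-true (x ℕ.≟ x) ≡.refl)

  ↦-other : ∀ (g : ℕ → A) {x v y} → y ≢ x → (g [ x ↦ v ]) y ≡ g y
  ↦-other g {x} {v} {y} y≢x = ≡.cong (if_then v else g y) (dec-false (y ℕ.≟ x) y≢x)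

Memory : Set
Memory = ℕ → ℕ → ℕ

_[_,_≔_] : Memory → ℕ → ℕ → ℕ → Memory
M [ r , c ≔ v ] = M [ r ↦ M r [ c ↦ v ] ]

≔-same : ∀ M r c {v} → (M [ r , c ≔ v ]) r c ≡ v
≔-same M r c = ≡.trans (≡.cong (λ row → row c) (↦-same M r)) (↦-same (M r) c)

≔-other-row : ∀ M {r c v r′} c′ → r′ ≢ r → (M [ r , c ≔ v ]) r′ c′ ≡ M r′ c′
≔-other-row M c′ r′≢r = ≡.cong (λ row → row c′) (↦-other M r′≢r)

≔-other-column : ∀ M {r c v} r′ {c′} → c′ ≢ c → (M [ r , c ≔ v ]) r′ c′ ≡ M r′ c′
≔-other-column M {r} r′ {c′} c′≢c with r′ ℕ.≟ r
... | yes ≡.refl = ≡.trans (≡.cong (λ row → row c′) (↦-same M r)) (↦-other (M r) c′≢c)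
... | no  r′≢r   = ≔-other-row M c′ r′≢r

∉⇒outside : ∀ {m i} (A : Subset m) → i ∉ A → lookup A i ≡ outside
∉⇒outside {i = i} A i∉A = ¬-not (i∉A ∘ lookup⇒[]= i A)

lookup-add-self : ∀ {m} u (A : Subset m) → lookup (A ∪ ⁅ u ⁆) u ≡ inside
lookup-add-self u A = []=⇒lookup (q⊆p∪q A ⁅ u ⁆ (x∈⁅x⁆ u))

lookup-add-other : ∀ {m i} u (A : Subset m) → i ≢ u → lookup (A ∪ ⁅ u ⁆) i ≡ lookup A i
lookup-add-other {i = i} u A i≢u = ≡.trans (lookup-zipWith _ i A ⁅ u ⁆)
  (≡.trans (≡.cong (lookup A i ∨_) (∉⇒outside ⁅ u ⁆ (x≢y⇒x∉⁅y⁆ i≢u))) (∨-identityʳ _))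

encode : ∀ {n} → Maybe (Fin n) → ℕ
encode nothing  = 0
encode (just j) = suc (toℕ j)

module _ {n m : ℕ} where

  record Stores (M : Memory) (S : Allocation n m) : Set where
    constructor stores
    field cell : ∀ j i → does (1 ℕ.≤? M (suc (toℕ j)) (toℕ i)) ≡ lookup (lookup S j) i
  open Stores public

  -- Address and value are register contents, known only propositionally; hence the equations among
  -- the arguments.
  stores-allocate : ∀ {M S r c v} b u → r ≡ encode b → c ≡ toℕ u → v ≡ 1 →
                    Stores M S → Stores (M [ r , c ≔ v ]) (allocate b u S)
  stores-allocate {M} {S} nothing u ≡.refl ≡.refl ≡.refl stored .cell j i =
    ≡.trans (≡.cong (does ∘ (1 ℕ.≤?_)) (≔-other-row M {0} {toℕ u} {1} {suc (toℕ j)} (toℕ i) λ ())) (cell stored j i)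
  stores-allocate {M} {S} (just k) u ≡.refl ≡.refl ≡.refl stored .cell j i with j ≟ k | i ≟ u
  ... | yes ≡.refl | yes ≡.refl
    rewrite lookup-allocate-self {j = j} {i} S | ≔-same M (suc (toℕ j)) (toℕ i) {1} = ≡.sym (lookup-add-self i (lookup S j))
  ... | yes ≡.refl | no i≢u
    rewrite lookup-allocate-self {j = j} {u} S
          | ≔-other-column M {suc (toℕ j)} {toℕ u} {1} (suc (toℕ j)) (i≢u ∘ toℕ-injective)
          = ≡.trans (cell stored j i) (≡.sym (lookup-add-other u (lookup S j) i≢u))
  ... | no j≢k | _
    rewrite lookup-allocate-other {b = just k} {u = u} S (j≢k ∘ ≡.sym ∘ just-injective)
          | ≔-other-row M {suc (toℕ k)} {toℕ u} {1} (toℕ i) (j≢k ∘ toℕ-injective ∘ ℕ.suc-injective)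
          = cell stored j i

  -- Erasing the cell agrees with its earlier meaning because `u` did not belong to bidder `k`.
  stores-restore : ∀ {M S r c v v′} k u → r ≡ suc (toℕ k) → c ≡ toℕ u → v′ ≡ 0 → u ∉ lookup S k →
                   Stores M S → Stores (M [ r , c ≔ v ] [ r , c ≔ v′ ]) S
  stores-restore {M} {S} {v = v} k u ≡.refl ≡.refl ≡.refl u∉S stored .cell j i with j ≟ k | i ≟ u
  ... | yes ≡.refl | yes ≡.refl
    rewrite ≔-same (M [ suc (toℕ j) , toℕ i ≔ v ]) (suc (toℕ j)) (toℕ i) {0} = ≡.sym (∉⇒outside (lookup S j) u∉S)
  ... | yes ≡.refl | no i≢u
    rewrite ≔-other-column (M [ suc (toℕ j) , toℕ u ≔ v ]) {suc (toℕ j)} {toℕ u} {0} (suc (toℕ j)) (i≢u ∘ toℕ-injective)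
          | ≔-other-column M {suc (toℕ j)} {toℕ u} {v} (suc (toℕ j)) (i≢u ∘ toℕ-injective)
          = cell stored j i
  ... | no j≢k | _
    rewrite ≔-other-row (M [ suc (toℕ k) , toℕ u ≔ v ]) {suc (toℕ k)} {toℕ u} {0} (toℕ i) (j≢k ∘ toℕ-injective ∘ ℕ.suc-injective)
          | ≔-other-row M {suc (toℕ k)} {toℕ u} {v} (toℕ i) (j≢k ∘ toℕ-injective ∘ ℕ.suc-injective)
          = cell stored j i

-- The program refines the greedy model

module Machine {c ℓ₁ ℓ₂} (K : OrderedField c ℓ₁ ℓ₂) {n m : ℕ} (I : OnlineWelfare.Instance K n m) where

  open OrderedField K
  open OnlineWelfare K
  open Auction K {n}
  open Greedy K I

  -- Since `A` consists of arrived items, the oracle's restriction to `X` leaves the query intact.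
  oracle-value : ∀ {X A x} {χ : ℕ → ℕ} j → x ≡ toℕ j → A ⊆ X →
                 (∀ i → does (1 ℕ.≤? χ (toℕ i)) ≡ lookup A i) → oracle sample-greedy I X x χ ≡ utility I j A
  oracle-value {X} {A} j ≡.refl A⊆X χ≗A with toℕ j ℕ.<? n
  ... | no  j≮n = contradiction (toℕ<n j) j≮n
  ... | yes j<n = ≡.cong₂ (utility I) (fromℕ<-toℕ j j<n)
    (≡.trans (≡.cong (_∩ X) (≡.trans (tabulate-cong χ≗A) (tabulate∘lookup A)))
      (⊆-antisym (proj₁ ∘ x∈p∩q⁻ A X) (λ x∈A → x∈p∩q⁺ (x∈A , A⊆X x∈A))))

  assign-encode : ∀ b u S → assign sample-greedy I (encode b) u S ≡ allocate b u S
  assign-encode nothing  u S = ≡.refl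
  assign-encode (just j) u S with toℕ j ℕ.<? n
  ... | no  j≮n = contradiction (toℕ<n j) j≮n
  ... | yes j<n = ≡.cong (λ k → updateAt S k (_∪ ⁅ u ⁆)) (fromℕ<-toℕ j j<n)

  record Ready (S : Allocation n m) (σ : State) : Set where
    field
      bidders≡ : regᵢ σ bidders-reg ≡ n
      stored   : Stores (memᵢ σ) S

  module _ (u : Fin m) (S : Allocation n m) {X : Subset m} (u∉X : u ∉ X) (S⊆X : ∀ j → lookup S j ⊆ X) where

    private
      f = oracle sample-greedy I (X ∪ ⁅ u ⁆)

    -- The loop invariant: the bidders below `k` remain, and `b` is the running best.
    record Scanning (k : ℕ) (σ : State) (b : Maybe (Fin n)) : Set c where
      field
        ready   : Ready S σ
        item≡   : regᵢ σ item-reg ≡ toℕ u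
        output≡ : regᵢ σ output-reg ≡ encode b
        row≡    : regᵢ σ row-reg ≡ k
        one≡    : regᵢ σ one-reg ≡ 1
        zero≡   : regᵢ σ zero-reg ≡ 0
        best≡   : regₖ σ best-reg ≡ worth S u b
      open Ready ready public

    -- The comparison reads `gain-reg`, while the update of `best-reg` recomputes the difference, so
    -- both are recorded.
    record Measured (j : Fin n) (σ : State) (b : Maybe (Fin n)) : Set c where
      field
        scanning    : Scanning (suc (toℕ j)) σ b
        difference≡ : regₖ σ with-reg - regₖ σ without-reg ≡ worth S u (just j)
        gain≡       : regₖ σ gain-reg ≡ worth S u (just j)
      open Scanning scanning public

    measure-refines : ∀ {σ b} j → Scanning (suc (toℕ j)) σ b →
                      Refines (Measured j) 6 (exec f measure σ) (return b)
    measure-refines {σ} {b} j sc = tick (tick (tick (tick (tick (tick (return record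
      { scanning = record
        { ready = record
          { bidders≡ = bidders≡
          ; stored   = stores-restore j u row≡ item≡ zero≡ (u∉X ∘ S⊆X j) stored
          }
        ; item≡ = item≡ ; output≡ = output≡ ; row≡ = row≡ ; one≡ = one≡ ; zero≡ = zero≡ ; best≡ = best≡
        }
      ; difference≡ = difference
      ; gain≡       = difference
      }))))))
      where
      open Scanning sc
      bidder : regᵢ σ row-reg ℕ.∸ regᵢ σ one-reg ≡ toℕ j
      bidder = ≡.cong₂ ℕ._∸_ row≡ one≡
      r = regᵢ σ row-reg
      M = memᵢ σ
      without : f (r ℕ.∸ regᵢ σ one-reg) (M r) ≡ utility I j (lookup S j)
      without = oracle-value j bidder (⊆-trans (S⊆X j) (p⊆p∪q ⁅ u ⁆))
        (λ i → ≡.trans (≡.cong (λ r → does (1 ℕ.≤? M r (toℕ i))) row≡) (cell stored j i))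
      M′ = M [ r , regᵢ σ item-reg ≔ regᵢ σ one-reg ]
      with′ : f (r ℕ.∸ regᵢ σ one-reg) (M′ r) ≡ utility I j (lookup S j ∪ ⁅ u ⁆)
      with′ = oracle-value j bidder (∪-monoˡ-⊆ (S⊆X j))
        (λ i → ≡.trans (≡.cong (λ r → does (1 ℕ.≤? M′ r (toℕ i))) row≡)
          (≡.trans (cell (stores-allocate (just j) u row≡ item≡ one≡ stored) j i)
            (≡.cong (λ A → lookup A i) (lookup-allocate-self {j = j} {u} S))))
      difference : f (r ℕ.∸ regᵢ σ one-reg) (M′ r) - f (r ℕ.∸ regᵢ σ one-reg) (M r) ≡ worth S u (just j)
      difference = ≡.cong₂ _-_ with′ without

    advance-refines : ∀ {k σ b} → Scanning (suc k) σ b →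
                      Refines (Scanning k) 1 (exec f (subᵢ row-reg row-reg one-reg) σ) (return b)
    advance-refines sc = tick (return record
      { ready = record { bidders≡ = bidders≡ ; stored = stored }
      ; item≡ = item≡ ; output≡ = output≡ ; row≡ = ≡.cong₂ ℕ._∸_ row≡ one≡
      ; one≡ = one≡ ; zero≡ = zero≡ ; best≡ = best≡
      })
      where open Scanning sc

    -- Of the 6 units, one is for the coin, at most 4 for the nested tests and the update, and one
    -- for moving to the next row.
    consider-refines : ∀ {σ b} j → Measured j σ b →
      Refines (Scanning (toℕ j)) 6 (exec f consider σ) (flip (return b) (return (better (worth S u) b j)))
    consider-refines {σ} {b} j me = tick (flip
      (refines->>= tails advance-refines)
      (refines->>= heads advance-refines))
      where
      open Measured me
      flipped : ∀ bit → Scanning (suc (toℕ j)) (set-regᵢ coin-reg bit σ) b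
      flipped bit = record
        { ready = record { bidders≡ = bidders≡ ; stored = stored }
        ; item≡ = item≡ ; output≡ = output≡ ; row≡ = row≡ ; one≡ = one≡ ; zero≡ = zero≡ ; best≡ = best≡
        }

      choose : Program
      choose = if best-reg ≤ₖ gain-reg then
          subᵢ output-reg row-reg zero-reg ⨾
          arith sub best-reg with-reg without-reg
        else skip

      sift : Program
      sift = if one-reg ≤ᵢ coin-reg then choose else skip

      tails : Refines (Scanning (suc (toℕ j))) 4 (exec f sift (set-regᵢ coin-reg 0 σ)) (return b)
      tails = tick (refines-if (_ ℕ.≤? 0)
        (λ 1≤0 → contradiction (≡.subst (ℕ._≤ 0) one≡ 1≤0) λ ())
        (λ _ → return (flipped 0)))

      chosen : Refines (Scanning (suc (toℕ j))) 3 (exec f choose (set-regᵢ coin-reg 1 σ))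
                 (return (better (worth S u) b j))
      chosen with better (worth S u) b j | better-view (worth S u) b j
      ... | _ | replaced b≤j = tick (refines-if (_ ≤? _)
        (λ _ → tick (tick (return record
          { ready = record { bidders≡ = bidders≡ ; stored = stored }
          ; item≡ = item≡ ; output≡ = ≡.cong₂ ℕ._∸_ row≡ zero≡ ; row≡ = row≡
          ; one≡ = one≡ ; zero≡ = zero≡ ; best≡ = difference≡
          })))
        (λ b≰j → contradiction (≡.subst₂ _≤_ (≡.sym best≡) (≡.sym gain≡) b≤j) b≰j))
      ... | _ | kept b≰j = tick (refines-if (_ ≤? _)
        (λ b≤j → contradiction (≡.subst₂ _≤_ best≡ gain≡ b≤j) b≰j)
        (λ _ → return (flipped 1)))

      heads : Refines (Scanning (suc (toℕ j))) 4 (exec f sift (set-regᵢ coin-reg 1 σ))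
                (return (better (worth S u) b j))
      heads = tick (refines-if (_ ℕ.≤? 1)
        (λ _ → chosen)
        (λ 1≰1 → contradiction (ℕ.≤-reflexive one≡) 1≰1))

    scan-refines : ∀ k .(k≤n : k ℕ.≤ n) {σ b} → Scanning k σ b →
      Refines (Scanning 0) (k ℕ.* 13) (iterate k (exec f (measure ⨾ consider)) σ) (scan (worth S u) (below k k≤n) b)
    scan-refines zero    _   sc = return sc
    -- A round costs 13: the tick of the loop, 6 for `measure` and 6 for `consider`.
    scan-refines (suc k) k<n {σ} {b} sc = tick (refines->>= {t = 12} body (scan-refines k (ℕ.<⇒≤ k<n)))
      where
      j = fromℕ< k<n
      body : Refines (Scanning k) 12 (exec f (measure ⨾ consider) σ) (flip (return b) (return (better (worth S u) b j)))
      -- The invariant counts with `k`, bidder `j` with `toℕ j`; they agree only propositionally.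
      body = ≡.subst (λ k → Scanning (suc k) σ b → Refines (Scanning k) 12 (exec f (measure ⨾ consider) σ)
                              (flip (return b) (return (better (worth S u) b j))))
        (toℕ-fromℕ< k<n)
        (λ sc → refines->>= {t = 6} (measure-refines j sc) (consider-refines j)) sc

    record Served (σ : State) (b : Maybe (Fin n)) : Set where
      field
        ready   : Ready (allocate b u S) σ
        output≡ : regᵢ σ output-reg ≡ encode b

    item-refines : ∀ {σ} → Ready S σ →
      Refines Served (7 ℕ.+ n ℕ.* 13) (exec f sample-greedy (set-regᵢ item-reg (toℕ u) σ)) (auction u S)
    item-refines {σ} rd = ≡.subst₂ (λ t q → Refines Served t (exec f sample-greedy (set-regᵢ item-reg (toℕ u) σ)) q)
      (≡.cong (6 ℕ.+_) (ℕ.+-comm (n ℕ.* 13) 1)) (>>=-identityʳ (auction u S))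
      -- Five ticks for `prepare` and one for entering the loop; the final store accounts for the
      -- seventh unit.
      (tick (tick (tick (tick (tick (tick (refines->>= scanned serve-winner)))))))
      where
      open Ready rd

      prepared : State
      prepared = set-regₖ best-reg 0# (set-regᵢ row-reg (regᵢ σ bidders-reg) (set-regᵢ zero-reg 0
        (set-regᵢ one-reg 1 (set-regᵢ output-reg 0 (set-regᵢ item-reg (toℕ u) σ)))))

      scanned : Refines (Scanning 0) (n ℕ.* 13)
        (iterate (regᵢ σ bidders-reg) (exec f (measure ⨾ consider)) prepared) (auction u S)
      scanned = ≡.subst (λ k → Refines (Scanning 0) (n ℕ.* 13) (iterate k _ prepared) (auction u S)) (≡.sym bidders≡)
        (scan-refines n ℕ.≤-refl record
          { ready = record { bidders≡ = bidders≡ ; stored = stored }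
          ; item≡ = ≡.refl ; output≡ = ≡.refl ; row≡ = bidders≡ ; one≡ = ≡.refl ; zero≡ = ≡.refl ; best≡ = ≡.refl
          })

      serve-winner : ∀ {τ b} → Scanning 0 τ b →
        Refines Served 1 (exec f (storeᵢ output-reg item-reg one-reg) τ) (return b)
      serve-winner {τ} {b} sc = tick (return record
        { ready   = record { bidders≡ = S.bidders≡ ; stored = stores-allocate b u S.output≡ S.item≡ S.one≡ S.stored }
        ; output≡ = S.output≡
        })
        where module S = Scanning sc

  serve-refines : ∀ us {X S σ} → Fresh us X → (∀ j → lookup S j ⊆ X) → Ready S σ →
    Refines _≡_ (List.length us ℕ.* (7 ℕ.+ n ℕ.* 13)) (serve sample-greedy I us X σ S) (greedy us S)
  serve-refines []       _                _   _     = return ≡.refl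
  serve-refines (u ∷ us) {X} {S} (u∉X , fresh) S⊆X ready =
    refines->>= (item-refines u S u∉X S⊆X ready) continue
    where
    continue : ∀ {σ b} → Served u S u∉X S⊆X σ b →
      Refines _≡_ (List.length us ℕ.* (7 ℕ.+ n ℕ.* 13))
        (serve sample-greedy I us (X ∪ ⁅ u ⁆) σ (assign sample-greedy I (regᵢ σ output-reg) u S))
        (greedy us (allocate b u S))
    continue {σ} {b} sv
      rewrite Served.output≡ sv | assign-encode b u S =
      serve-refines us fresh (λ j → lookup-allocate-⊆ b {S = S} (S⊆X j)) (Served.ready sv)

  run-refines : ∀ π → Refines _≡_ (m ℕ.* (7 ℕ.+ n ℕ.* 13)) (run sample-greedy I π) (greedy (arrivals π) nothing-allocated)
  run-refines π = ≡.subst (λ l → Refines _≡_ (l ℕ.* (7 ℕ.+ n ℕ.* 13)) (run sample-greedy I π) (greedy (arrivals π) nothing-allocated))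
    (length-tabulate (π ⟨$⟩ʳ_))
    (serve-refines (arrivals π) (arrivals-fresh π) empty record { bidders≡ = ≡.refl ; stored = stored })
    where
    empty : ∀ j → lookup nothing-allocated j ⊆ ⊥
    empty j = ⊆-reflexive (lookup-replicate j ⊥)
    stored : Stores (λ _ _ → 0) nothing-allocated
    stored .cell j i = ≡.sym (∉⇒outside (lookup nothing-allocated j) (∉⊥ ∘ empty j))

-- Polynomial running time and conclusion

polynomial-bound : ∀ n m → m ℕ.* (7 ℕ.+ n ℕ.* 13) ℕ.≤ 13 ℕ.* suc (n ℕ.+ m) ℕ.^ 2
polynomial-bound n m = begin
  m ℕ.* (7 ℕ.+ n ℕ.* 13)      ≤⟨ ℕ.*-mono-≤ (ℕ.≤-trans (ℕ.m≤n+m m n) (ℕ.n≤1+n _)) per-item ⟩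
  s ℕ.* (s ℕ.* 13)            ≡⟨ ℕ.*-assoc s s 13 ⟨
  s ℕ.* s ℕ.* 13              ≡⟨ ℕ.*-comm (s ℕ.* s) 13 ⟩
  13 ℕ.* (s ℕ.* s)            ≡⟨ ≡.cong (λ x → 13 ℕ.* (s ℕ.* x)) (ℕ.*-identityʳ s) ⟨
  13 ℕ.* s ℕ.^ 2              ∎
  where
  open ℕ.≤-Reasoning
  s = suc (n ℕ.+ m)
  per-item : 7 ℕ.+ n ℕ.* 13 ℕ.≤ s ℕ.* 13
  per-item = ℕ.+-mono-≤ (ℕ.m≤m+n 7 6) (ℕ.*-monoˡ-≤ 13 (ℕ.m≤m+n n m))

theorem1 : ∀ {c ℓ₁ ℓ₂} (K : OrderedField c ℓ₁ ℓ₂) →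
    let open OrderedField K
        open OnlineWelfare K
    in Σ[ A ∈ Algorithm ] PolynomialTime A ×
       (∀ {n m} (I : Instance n m) (π : Permutation′ m) → ¼ * optimum I ≤ 𝔼 (run A I π) (welfare I))
theorem1 K = sample-greedy
  , (13 , 2 , λ {n} {m} I π → ℕ.≤-trans (refines-time (Machine.run-refines K I π)) (polynomial-bound n m))
  -- Refinement preserves expectations, so the bound for the greedy model, taken at an optimal
  -- allocation, carries over to the program.
  , λ I π → ≤-respʳ-≈ (Eq.sym (refines-𝔼 K (Machine.run-refines K I π) (welfare I)))
      (Greedy.greedy-competitive K I (optimal-allocation I) (optimal-disjoint I) π)
  where
  open OnlineWelfare K
  open OrderedFieldProperties K using (≤-respʳ-≈; module Eq)
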